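{- In the semiclairvoyant model $\mathrm{SC}_2$ (base-2 classes) with unweighted flow time, the two-bin algorithm $\mathrm{ALG}$ described in the context (run with predictions $\tilde p_q=2^{\ell_q}$ and parameter $\mu=2$) is $4$-competitive: for every input $Q$, $F^{\mathrm{ALG}}(Q)\le 4\cdot F^{\mathrm{OPT}}(Q)$.
   Context: Single-machine online scheduling for unweighted flow time. An input is a finite set $Q$ of jobs; each job $q$ has a processing time $p_q>0$ and a release time $r_q\ge0$. At each time the machine processes at most one released, uncompleted job, at unit rate, with preemption allowed. Job $q$ completes at the time $c_q$ at which it has received $p_q$ units of processing. The cost of a schedule is $F=\sum_{q\in Q}(c_q-r_q)$; $F^{\mathrm{OPT}}(Q)$ is the minimum cost of an offline schedule knowing the entire input. In the semiclairvoyant model $\mathrm{SC}_2$, an online algorithm learns of $q$ only at time $r_q$, when it is told the class $\ell_q=\lfloor\log_2 p_q\rfloor$ but not $p_q$; it observes completions when they happen. Set $\tilde p_q=2^{\ell_q}$ and $\mu=2$. The algorithm. Each pending job is in one of two bins, a full bin $F$ and a partial bin $P$, with job sets $Q_F,Q_P$ of cardinalities $\delta_F,\delta_P$ (initially empty). Bijective priority maps $\pi_F:Q_F\to\{1,\dots,\delta_F\}$ and $\pi_P:Q_P\to\{1,\dots,\delta_P\}$ are maintained. For $q_1,q_2\in Q_F$, the ordered pair $(q_1,q_2)$ is a violation if $\pi_F(q_1)>\pi_F(q_2)$ and $\mu\tilde p_{q_2}\le\tilde p_{q_1}$. (1) UponJobRelease($q$), called upon the release of job $q$: add $q$ to $Q_F$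 and set $\pi_F(q)\leftarrow\delta_F$ (after the addition, so $q$ gets top priority). If there are jobs $q'\in Q_F\setminus\{q\}$ such that $(q,q')$ is a violation, let $q_1,\dots,q_m$ be all of them, ordered so that $\pi_F(q)>\pi_F(q_1)>\dots>\pi_F(q_m)$, and simultaneously give $q$ the old priority of $q_m$, each $q_k$ with $k\ge2$ the old priority of $q_{k-1}$, and $q_1$ the old priority of $q$; other priorities are unchanged. (2) UponHeavyF, called whenever $\delta_F>\delta_P$: the job $q\in Q_F$ with $\pi_F(q)=\delta_F$ is moved from $F$ to $P$, and $\pi_P(q)\leftarrow\delta_P$ (after the move). (3) Process, at every time: process the job $q\in Q_P$ with $\pi_P(q)=\delta_P$ (if any job is pending). Completed jobs are removed. -}

module Defs where

open import Algebra.Bundles using (CommutativeRing; Semiring)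
open import Algebra.Structures using (IsCommutativeRing)
import Algebra.Definitions.RawSemiring as RawSemiringDefs
import Algebra.Properties.Ring as RingProperties
import Algebra.Construct.NaturalChoice.Min as NaturalMin
import Algebra.Construct.NaturalChoice.Max as NaturalMax
open import Data.Empty using (⊥-elim)
open import Data.Fin using (Fin; _≟_)
import Data.Integer as ℤ
open ℤ using (ℤ; -[1+_]) renaming (+_ to pos)
import Data.Integer.Properties as ℤₚ
open import Data.List using (List; []; _∷_; _++_; [_]; filter; length; allFin)
open import Data.List.Relation.Binary.Permutation.Propositional using (_↭_)
open import Data.List.Relation.Unary.All using (All)
open import Data.List.Relation.Unary.AllPairs using (AllPairs)
open import Data.Nat using (ℕ; zero; suc)
import Data.Nat as ℕ
open import Data.Product using (Σ; ∃; _×_; _,_; proj₁; proj₂)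
open import Data.Sum using (inj₁; inj₂)
open import Data.Vec.Functional using (Vector; updateAt)
open import Function using (const)
open import Relation.Binary.Bundles using (DecTotalOrder)
open import Relation.Binary.PropositionalEquality
  using (_≡_; _≢_; refl; sym; trans; cong; subst; subst₂)
open import Relation.Binary.Structures using (IsDecTotalOrder)
import Relation.Binary.Construct.NonStrictToStrict as NonStrictToStrict
open import Relation.Nullary using (yes; no)

-- The number system for times. The real numbers (with classical logic) are an
-- instance, and so is ℚ.
record ArchimedeanOrderedField : Set₁ where
  infixl 6 _+_
  infixl 7 _*_
  infix  8 -_
  infix  9 _⁻¹
  infix  4 _≤_
  field
    Carrier           : Set
    _+_ _*_           : Carrier → Carrier → Carrier
    -_                : Carrier → Carrier
    0# 1#             : Carrier
    isCommutativeRing : IsCommutativeRing _≡_ _+_ _*_ -_ 0# 1#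

    -- The value of 0# ⁻¹ is unconstrained.
    _⁻¹               : Carrier → Carrier
    *-inverseʳ        : ∀ x → x ≢ 0# → x * x ⁻¹ ≡ 1#
    0≢1               : 0# ≢ 1#

    _≤_               : Carrier → Carrier → Set
    isDecTotalOrder   : IsDecTotalOrder _≡_ _≤_
    +-monoʳ-≤         : ∀ z {x y} → x ≤ y → z + x ≤ z + y
    *-nonNeg          : ∀ {x y} → 0# ≤ x → 0# ≤ y → 0# ≤ x * y

  commutativeRing : CommutativeRing _ _
  commutativeRing = record { isCommutativeRing = isCommutativeRing }

  open RawSemiringDefs (Semiring.rawSemiring (CommutativeRing.semiring commutativeRing)) public
    using (_^_; sum) renaming (_×_ to _·_)

  field
    archimedean       : ∀ x → ∃ λ n → x ≤ n · 1#

  decTotalOrder : DecTotalOrder _ _ _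
  decTotalOrder = record { isDecTotalOrder = isDecTotalOrder }

  open DecTotalOrder decTotalOrder public
    using (_≤?_; total; totalOrder)
    renaming (refl to ≤-refl; trans to ≤-trans; antisym to ≤-antisym)

  open NonStrictToStrict _≡_ _≤_ public using (_<_)
  open NaturalMin totalOrder public using (_⊓_)
  open NaturalMax totalOrder public using (_⊔_)

  infixl 6 _-_
  _-_ : Carrier → Carrier → Carrier
  x - y = x + - y

  2# : Carrier
  2# = 1# + 1#

  2^_ : ℤ → Carrier
  2^ (pos n)    = 2# ^ n
  2^ -[1+ n ] = (2# ^ suc n) ⁻¹

module BinaryLog (K : ArchimedeanOrderedField) where

  open ArchimedeanOrderedField K
  open CommutativeRing commutativeRing
    using (ring; +-identityʳ; +-identityˡ; +-comm; +-assoc; -‿inverseʳ; -‿inverseˡ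
          ; *-identityˡ; *-identityʳ; *-comm; *-assoc; distribʳ; distribˡ; zeroˡ; zeroʳ)
  open RingProperties ring using (-‿distribʳ-*)

  +-mono-≤ : ∀ {a b c d} → a ≤ b → c ≤ d → a + c ≤ b + d
  +-mono-≤ {a} {b} {c} {d} a≤b c≤d =
    ≤-trans (+-monoʳ-≤ a c≤d)
      (subst₂ _≤_ (+-comm d a) (+-comm d b) (+-monoʳ-≤ d a≤b))

  x≤y⇒0≤y-x : ∀ {x y} → x ≤ y → 0# ≤ y - x
  x≤y⇒0≤y-x {x} {y} x≤y =
    subst₂ _≤_ (-‿inverseˡ x) (+-comm (- x) y) (+-monoʳ-≤ (- x) x≤y)

  0≤y-x⇒x≤y : ∀ {x y} → 0# ≤ y - x → x ≤ y
  0≤y-x⇒x≤y {x} {y} h =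
    subst₂ _≤_ (+-identityʳ x)
      (trans (cong (x +_) (+-comm y (- x)))
        (trans (sym (+-assoc x (- x) y))
          (trans (cong (_+ y) (-‿inverseʳ x)) (+-identityˡ y))))
      (+-monoʳ-≤ x h)

  *-monoʳ-≤ : ∀ {z x y} → 0# ≤ z → x ≤ y → z * x ≤ z * y
  *-monoʳ-≤ {z} {x} {y} 0≤z x≤y = 0≤y-x⇒x≤y
    (subst (0# ≤_)
      (trans (distribˡ z y (- x)) (cong (_+_ (z * y)) (sym (-‿distribʳ-* z x))))
      (*-nonNeg 0≤z (x≤y⇒0≤y-x x≤y)))

  0≤-1⇒0≤1 : 0# ≤ - 1# → 0# ≤ 1#
  0≤-1⇒0≤1 h = subst (0# ≤_) e (*-nonNeg h h)
    where
    open RingProperties ring using (-1*x≈-x; -‿involutive)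
    e : - 1# * - 1# ≡ 1#
    e = trans (-1*x≈-x (- 1#)) (-‿involutive 1#)

  0≤1 : 0# ≤ 1#
  0≤1 with total 0# 1#
  ... | inj₁ h = h
  ... | inj₂ h = 0≤-1⇒0≤1 (subst (0# ≤_) (+-identityˡ (- 1#)) (x≤y⇒0≤y-x h))

  1≤2^n : ∀ n → 1# ≤ 2# ^ n
  1≤2^n zero    = ≤-refl
  1≤2^n (suc n) = subst (1# ≤_)
    (sym (trans (distribʳ (2# ^ n) 1# 1#)
      (trans (cong (_+ 1# * 2# ^ n) (*-identityˡ _)) (cong (_+_ (2# ^ n)) (*-identityˡ _)))))
    (subst (_≤ 2# ^ n + 2# ^ n) (+-identityʳ 1#)
      (+-mono-≤ (1≤2^n n) (≤-trans 0≤1 (1≤2^n n))))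

  n+1≤2^n : ∀ n → suc n · 1# ≤ 2# ^ n
  n+1≤2^n zero    = subst (_≤ 1#) (sym (+-identityʳ 1#)) ≤-refl
  n+1≤2^n (suc n) = subst (suc (suc n) · 1# ≤_)
    (sym (trans (distribʳ (2# ^ n) 1# 1#)
      (trans (cong (_+ 1# * 2# ^ n) (*-identityˡ _)) (cong (_+_ (2# ^ n)) (*-identityˡ _)))))
    (+-mono-≤ (1≤2^n n) (n+1≤2^n n))

  ≰⇒< : ∀ {x y} → (y ≤ x → 0# ≡ 1#) → x < y
  ≰⇒< {x} {y} h with total x y
  ... | inj₁ x≤y = x≤y , λ { refl → 0≢1 (h ≤-refl) }
  ... | inj₂ y≤x = ⊥-elim (0≢1 (h y≤x))

  n<n+1 : ∀ n → n · 1# < suc n · 1#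
  n<n+1 n =
    subst (_≤ 1# + n · 1#) (+-identityˡ _) (+-mono-≤ 0≤1 ≤-refl) ,
    (λ e → 0≢1 (sym (identityˡ-unique 1# (n · 1#) (sym e))))
    where open RingProperties ring using () renaming (+-identityˡ-unique to identityˡ-unique)

  upper : ∀ x → ∃ λ n → x < 2# ^ n
  upper x with archimedean x
  ... | n , x≤n = n , ≰⇒< λ 2^n≤x →
    ⊥-elim (proj₂ (n<n+1 n) (≤-antisym (proj₁ (n<n+1 n))
      (≤-trans (n+1≤2^n n) (≤-trans 2^n≤x x≤n))))

  pow-inverse : ∀ n → 2# ^ n * (2# ^ n) ⁻¹ ≡ 1#
  pow-inverse n = *-inverseʳ _ λ e →
    0≢1 (≤-antisym 0≤1 (subst (1# ≤_) e (1≤2^n n)))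

  inverse-nonNeg : ∀ {x y} → 0# ≤ x → x * y ≡ 1# → 0# ≤ y
  inverse-nonNeg {x} {y} 0≤x xy≡1 with total 0# y
  ... | inj₁ 0≤y = 0≤y
  ... | inj₂ y≤0 = ⊥-elim (0≢1 (≤-antisym 0≤1
    (subst₂ _≤_ xy≡1 (zeroʳ x) (*-monoʳ-≤ 0≤x y≤0))))

  -- x⁻¹ ≤ z implies z⁻¹ ≤ x
  swap-inverse : ∀ {x y z w} → 0# ≤ x → 0# ≤ w → x * y ≡ 1# → z * w ≡ 1# → y ≤ z → w ≤ x
  swap-inverse {x} {y} {z} {w} 0≤x 0≤w xy≡1 zw≡1 y≤z =
    subst₂ _≤_
      (trans (cong (w *_) xy≡1) (*-identityʳ w))
      (trans (*-comm w (x * z))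
        (trans (*-assoc x z w) (trans (cong (x *_) zw≡1) (*-identityʳ x))))
      (*-monoʳ-≤ 0≤w (*-monoʳ-≤ 0≤x y≤z))

  lower : ∀ {p} → 0# < p → ∃ λ m → 2^ (ℤ.- (pos m)) ≤ p
  lower {p} (0≤p , 0≢p) with upper (p ⁻¹)
  ... | m , (p⁻¹≤2^m , _) = suc m ,
    swap-inverse 0≤p
      (inverse-nonNeg (≤-trans 0≤1 (1≤2^n (suc m))) (pow-inverse (suc m)))
      (*-inverseʳ p (λ e → 0≢p (sym e))) (pow-inverse (suc m))
      (≤-trans p⁻¹≤2^m
        (subst₂ _≤_ (*-identityʳ (2# ^ m))
          (*-comm (2# ^ m) 2#)
          (*-monoʳ-≤ (≤-trans 0≤1 (1≤2^n m))
            (subst (_≤ 2#) (+-identityʳ 1#) (+-monoʳ-≤ 1# 0≤1)))))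

  search : ∀ {p} k ℓ → 2^ ℓ ≤ p → p < 2^ (ℓ ℤ.+ pos k) →
           ∃ λ ℓ′ → 2^ ℓ′ ≤ p × p < 2^ (ℓ′ ℤ.+ pos 1)
  search {p} zero ℓ lo (hi , ne) rewrite ℤₚ.+-identityʳ ℓ = ⊥-elim (ne (≤-antisym hi lo))
  search {p} (suc k) ℓ lo hi with 2^ (ℓ ℤ.+ pos 1) ≤? p
  ... | yes lo′ = search k (ℓ ℤ.+ pos 1) lo′
                    (subst (λ i → p < 2^ i) (sym (ℤₚ.+-assoc ℓ (pos 1) (pos k))) hi)
  ... | no  p≱  with total p (2^ (ℓ ℤ.+ pos 1))
  ...   | inj₁ p≤ = ℓ , lo , p≤ , λ e → p≱ (subst (2^ (ℓ ℤ.+ pos 1) ≤_) (sym e) ≤-refl)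
  ...   | inj₂ ≤p = ⊥-elim (p≱ ≤p)

  floorLog₂ : ∀ p → 0# < p → ∃ λ ℓ → 2^ ℓ ≤ p × p < 2^ (ℓ ℤ.+ pos 1)
  floorLog₂ p 0<p with lower 0<p | upper p
  ... | m , lo | n , hi = search (m ℕ.+ n) (ℤ.- (pos m)) lo
    (subst (λ i → p < 2^ i)
      (sym (trans (sym (ℤₚ.+-assoc (ℤ.- (pos m)) (pos m) (pos n)))
        (trans (cong (ℤ._+ pos n) (ℤₚ.+-inverseˡ (pos m))) (ℤₚ.+-identityˡ (pos n)))))
      hi)

module Scheduling (K : ArchimedeanOrderedField) where

  open ArchimedeanOrderedField K
  open BinaryLog K using (floorLog₂)

  record Job : Set where
    field
      processing   : Carrier
      release      : Carrier
      processing>0 : 0# < processing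
      release≥0    : 0# ≤ release

    class : ℤ
    class = proj₁ (floorLog₂ processing processing>0)

  open Job public

  -- Jobs are identified by their index, so that distinct jobs may have the
  -- same processing and release times.
  Input : ℕ → Set
  Input n = Fin n → Job

  flowTime : ∀ {n} → Input n → Vector Carrier n → Carrier
  flowTime Q c = sum (λ q → c q - release (Q q))

  -- The machine works on `job` during the whole interval [start , stop).
  record Slice (n : ℕ) : Set where
    field
      job        : Fin n
      start stop : Carrier
      start<stop : start < stop

  open Slice public

  -- The machine is idle outside the slices.
  record Schedule (n : ℕ) : Set where
    field
      slices     : List (Slice n)
      completion : Vector Carrier n

  open Schedule public

  received : ∀ {n} → List (Slice n) → Fin n → Carrier → Carrier
  received []       q t = 0#
  received (s ∷ ss) q t with job s ≟ q
  ... | yes _ = (0# ⊔ (t ⊓ stop s - start s)) + received ss q t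
  ... | no  _ = received ss q t

  record Feasible {n} (Q : Input n) (S : Schedule n) : Set where
    field
      disjoint    : AllPairs (λ s s′ → stop s ≤ start s′) (slices S)
      released    : All (λ s → release (Q (job s)) ≤ start s) (slices S)
      uncompleted : All (λ s → stop s ≤ completion S (job s)) (slices S)
      -- completion S q is the first time at which q has received its
      -- processing time.
      completed   : ∀ q → received (slices S) q (completion S q) ≡ processing (Q q)
      first       : ∀ q t → t < completion S q →
                    received (slices S) q t < processing (Q q)

  cost : ∀ {n} → Input n → Schedule n → Carrier
  cost Q S = flowTime Q (completion S)

  IsOPT : ∀ {n} → Input n → Carrier → Set
  IsOPT Q v = (∃ λ S → Feasible Q S × cost Q S ≡ v)
            × (∀ S → Feasible Q S → v ≤ cost Q S)

  -- The order in which the jobs are announced to an online algorithm; jobs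
  -- released at the same time are announced one after the other, in any order.
  record ReleaseOrder {n} (Q : Input n) : Set where
    field
      sequence    : List (Fin n)
      enumerates  : sequence ↭ allFin n
      sorted      : AllPairs (λ i j → release (Q i) ≤ release (Q j)) sequence

  open ReleaseOrder public

  -- A bin is the list of its jobs by decreasing priority: in a bin of size δ the
  -- head has priority δ and the last job has priority 1.
  Bin : ℕ → Set
  Bin n = List (Fin n)

  -- The bin operations see the jobs only through the predictions p̃.
  module Bins {n : ℕ} (μ : Carrier) (p̃ : Vector Carrier n) where

    -- Replace from the front on, one by one, those members q′ of a bin with
    -- μ p̃(q′) ≤ p̃(q) by the elements of the first list.
    refill : Fin n → List (Fin n) → Bin n → Bin n
    refill q []       xs       = xs
    refill q (y ∷ ys) []       = []
    refill q (y ∷ ys) (x ∷ xs) with μ * p̃ x ≤? p̃ q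
    ... | yes _ = y ∷ refill q ys xs
    ... | no  _ = x ∷ refill q (y ∷ ys) xs

    -- With q on top, the violations (q , q′) are the q′ in the old bin with
    -- μ p̃(q′) ≤ p̃(q). If they are q₁, …, qₘ from the top down, then the positions
    -- of q, q₁, …, qₘ are filled with q₁, …, qₘ, q in this order.
    uponJobRelease : Fin n → Bin n → Bin n
    uponJobRelease q F with filter (λ x → μ * p̃ x ≤? p̃ q) F
    ... | []     = q ∷ F
    ... | y ∷ ys = y ∷ refill q (ys ++ [ q ]) F

    -- Calls of UponHeavyF for as long as the full bin is the larger one.
    uponHeavyF : Bin n → Bin n → Bin n × Bin n
    uponHeavyF []      P = [] , P
    uponHeavyF (q ∷ F) P with length P ℕ.<? length (q ∷ F)
    ... | yes _ = uponHeavyF F (q ∷ P)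
    ... | no  _ = (q ∷ F) , P

  record State (n : ℕ) : Set where
    field
      clock       : Carrier
      unreleased  : List (Fin n)
      full        : Bin n
      partial     : Bin n
      remaining   : Vector Carrier n
      completedAt : Vector Carrier n   -- meaningful for completed jobs only

  module TwoBin {n : ℕ} (Q : Input n) (μ : Carrier) (p̃ : Vector Carrier n) where

    open Bins μ p̃

    -- Arguments: clock, unreleased jobs, bins (before the calls of UponHeavyF),
    -- remaining processing times, completion times.
    rebalanced : Carrier → List (Fin n) → Bin n → Bin n →
                 Vector Carrier n → Vector Carrier n → State n
    rebalanced t qs F P rem c = record
      { clock = t ; unreleased = qs
      ; full = proj₁ (uponHeavyF F P) ; partial = proj₂ (uponHeavyF F P)
      ; remaining = rem ; completedAt = c }

    -- Run to the next event, which is the completion of the top job of the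
    -- partial bin or the next release, whichever comes first. A job that completes
    -- at a release time is no longer pending when that release is handled.
    step : State n → State n
    step s = next (State.unreleased s) (State.partial s)
      where
      open State s

      complete : Fin n → Bin n → State n
      complete j P = rebalanced t unreleased full P
                       (updateAt remaining j (const 0#)) (updateAt completedAt j (const t))
        where
        t : Carrier
        t = clock + remaining j

      next : List (Fin n) → Bin n → State n
      next []       []      = s
      next []       (j ∷ P) = complete j P
      next (q ∷ qs) []      =
        rebalanced (release (Q q)) qs (uponJobRelease q full) [] remaining completedAt
      next (q ∷ qs) (j ∷ P) with clock + remaining j ≤? release (Q q)
      ... | yes _ = complete j P
      ... | no  _ =
        rebalanced (release (Q q)) qs (uponJobRelease q full) (j ∷ P)
          (updateAt remaining j (_- (release (Q q) - clock))) completedAt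

    steps : ℕ → State n → State n
    steps zero    s = s
    steps (suc k) s = steps k (step s)

    initial : ReleaseOrder Q → State n
    initial o = record
      { clock = 0# ; unreleased = sequence o ; full = [] ; partial = []
      ; remaining = λ q → processing (Q q) ; completedAt = λ _ → 0# }

    -- There are 2n events in total: n releases and n completions.
    completionTimes : ReleaseOrder Q → Vector Carrier n
    completionTimes o = State.completedAt (steps (2 ℕ.* n) (initial o))

  costALG : ∀ {n} (Q : Input n) → ReleaseOrder Q → Carrier
  costALG Q o = flowTime Q (TwoBin.completionTimes Q 2# (λ q → 2^ class (Q q)) o)

{-# OPTIONS --safe #-}
-- The two bins always satisfy |F| ≤ |P| ≤ |F| + 1, so it suffices to show that the
-- partial bin has at most 2a jobs whenever a schedule S has a unfinished jobs; the
-- flow times are then compared by integrating over time.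
--
-- For this, the remaining volume of all but the 2a jobs of lowest priority in each
-- bin is bounded by the remaining volume in S of all released jobs except any a of
-- them. While the top of P is processed, the left-hand side either is zero or
-- decreases at full speed. Let a job q be released. If it is not among the a excluded
-- jobs, then both sides grow by its size. If it is one of them, then the bound held
-- before with a − 1: the full bin is sorted by class, so the two further jobs that are
-- now dropped from it weigh together at least as much as q if q is placed above them.
-- A move from F to P happens only if |F| = |P| + 1, so that the moved job has
-- equally many jobs below it in both bins.

module Submission where

open import Defs
open import Algebra.Bundles using (CommutativeRing)
open import Algebra.Construct.NaturalChoice.Base using (module MaxOperator; module MinOperator)
import Algebra.Construct.NaturalChoice.Max as NaturalMax
import Algebra.Construct.NaturalChoice.Min as NaturalMin
import Algebra.Construct.NaturalChoice.MinMaxOp as MinMaxOp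
import Algebra.Properties.CommutativeMonoid.Mult as CommutativeMonoidMult
import Algebra.Properties.CommutativeSemigroup as CommutativeSemigroupProperties
import Algebra.Solver.CommutativeMonoid as CommutativeMonoidSolver
open import Data.Fin using (Fin; _≟_)
open import Data.List using (List; []; _∷_; _++_; [_]; length; filter; tabulate; allFin)
import Data.Integer as ℤ
import Data.Integer.Properties as ℤₚ
open import Data.List.Properties using (filter-none; length-++; length-tabulate; ++-identityʳ)
open import Data.List.Relation.Binary.Permutation.Propositional as Perm using (_↭_)
open import Data.List.Relation.Binary.Permutation.Propositional.Properties
  using (All-resp-↭; ↭-length; shift; ++⁺ˡ; ++⁺ʳ)
open import Data.List.Relation.Binary.Permutation.Setoid.Properties using (Unique-resp-↭)
open import Data.List.Relation.Ternary.Interleaving.Propositional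
  using (Interleaving; []; consˡ; consʳ; toPermutation)
open import Data.List.Relation.Unary.All as All using (All; []; _∷_)
import Data.List.Relation.Unary.All.Properties as Allₚ
open import Data.List.Relation.Unary.AllPairs as AllPairs using (AllPairs; []; _∷_)
open import Data.List.Relation.Unary.Unique.Propositional.Properties using (allFin⁺)
open import Data.Nat as ℕ using (ℕ; zero; suc; s≤s; z≤n)
import Data.Nat.Properties as ℕₚ
open import Data.Product using (∃; ∃₂; _×_; _,_; proj₁; proj₂)
open import Data.Sum using (_⊎_; inj₁; inj₂)
open import Data.Vec.Functional using (Vector; updateAt)
open import Data.Vec.Functional.Properties using (updateAt-minimal; updateAt-updates)
open import Function using (_∘_; const; id)
open import Relation.Binary.Bundles using (DecTotalOrder)
open import Relation.Binary.PropositionalEquality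
  using (_≡_; _≢_; refl; sym; trans; cong; cong₂; subst; subst₂; setoid)
import Relation.Binary.Reasoning.PartialOrder as PartialOrderReasoning
open import Relation.Nullary using (¬_; Dec; yes; no; contradiction)

-- Arithmetic in ordered fields.

module OrderedField (K : ArchimedeanOrderedField) where

  open ArchimedeanOrderedField K
  open BinaryLog K using (+-mono-≤; x≤y⇒0≤y-x) public
  open CommutativeRing commutativeRing public
    using (+-identityˡ; +-identityʳ; +-comm; +-assoc; -‿inverseˡ; -‿inverseʳ; +-commutativeMonoid)
  open CommutativeRing commutativeRing using (+-commutativeSemigroup)
  open CommutativeSemigroupProperties +-commutativeSemigroup public
    using (interchange; xy∙z≈xz∙y; x∙yz≈y∙xz)
  open CommutativeMonoidMult +-commutativeMonoid public
    using () renaming (×-distrib-+ to ·-distrib-+; ×-assocˡ to ·-assocˡ)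
  open MinMaxOp (NaturalMin.minOperator totalOrder) (NaturalMax.maxOperator totalOrder) public
    using (x⊓y≤x; x⊓y≤y; ⊓-glb; ⊓-monoˡ-≤; x≤x⊔y; x≤y⊔x; ⊔-lub; ⊔-monoʳ-≤)
  open MinOperator (NaturalMin.minOperator totalOrder) public using (x≤y⇒x⊓y≈x; x≥y⇒x⊓y≈y)
  open MaxOperator (NaturalMax.maxOperator totalOrder) public using (x≤y⇒x⊔y≈y; x≥y⇒x⊔y≈x)
  open DecTotalOrder decTotalOrder using (poset)
  open DecTotalOrder decTotalOrder public using () renaming (reflexive to ≤-reflexive)
  open PartialOrderReasoning poset public
    using (begin_; begin-equality_; step-≤; step-≡-⟩; step-≡-⟨; step-≡-∣; _∎; _IsRelatedTo_)

  x-y+y≡x : ∀ x y → x - y + y ≡ x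
  x-y+y≡x x y = trans (+-assoc x (- y) y) (trans (cong (x +_) (-‿inverseˡ y)) (+-identityʳ x))

  x+y-y≡x : ∀ x y → x + y - y ≡ x
  x+y-y≡x x y = trans (+-assoc x y (- y)) (trans (cong (x +_) (-‿inverseʳ y)) (+-identityʳ x))

  0+0+x≡x : ∀ x → 0# + 0# + x ≡ x
  0+0+x≡x x = trans (cong (_+ x) (+-identityʳ 0#)) (+-identityˡ x)

  +-cancelʳ-≤ : ∀ z {x y} → x + z ≤ y + z → x ≤ y
  +-cancelʳ-≤ z {x} {y} h = subst₂ _≤_ (x+y-y≡x x z) (x+y-y≡x y z) (+-mono-≤ h ≤-refl)

  ≰⇒≥ : ∀ {x y} → ¬ x ≤ y → y ≤ x
  ≰⇒≥ {x} {y} x≰y with total x y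
  ... | inj₁ x≤y = contradiction x≤y x≰y
  ... | inj₂ y≤x = y≤x

  x≤y+x : ∀ {x y} → 0# ≤ y → x ≤ y + x
  x≤y+x {x} 0≤y = subst₂ _≤_ (+-identityˡ x) refl (+-mono-≤ 0≤y ≤-refl)

  x≤x+y : ∀ {x y} → 0# ≤ y → x ≤ x + y
  x≤x+y {x} 0≤y = subst₂ _≤_ (+-identityʳ x) refl (+-mono-≤ ≤-refl 0≤y)

  0≤x+y : ∀ {x y} → 0# ≤ x → 0# ≤ y → 0# ≤ x + y
  0≤x+y 0≤x 0≤y = ≤-trans 0≤y (x≤y+x 0≤x)

  ·-nonNeg : ∀ k {x} → 0# ≤ x → 0# ≤ k · x
  ·-nonNeg zero    0≤x = ≤-refl
  ·-nonNeg (suc k) 0≤x = 0≤x+y 0≤x (·-nonNeg k 0≤x)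

  ·-monoʳ-≤ : ∀ k {x y} → x ≤ y → k · x ≤ k · y
  ·-monoʳ-≤ zero    x≤y = ≤-refl
  ·-monoʳ-≤ (suc k) x≤y = +-mono-≤ x≤y (·-monoʳ-≤ k x≤y)

  ·-monoˡ-≤ : ∀ {j k x} → 0# ≤ x → j ℕ.≤ k → j · x ≤ k · x
  ·-monoˡ-≤ {k = k} 0≤x z≤n       = ·-nonNeg k 0≤x
  ·-monoˡ-≤         0≤x (s≤s j≤k) = +-mono-≤ ≤-refl (·-monoˡ-≤ 0≤x j≤k)

-- Finite sums and the weight of the upper part of a bin.

module Sums (K : ArchimedeanOrderedField) where

  open ArchimedeanOrderedField K
  open OrderedField K

  private variable
    A   : Set
    f g : A → Carrier
    xs ys : List A

  ∑ : (A → Carrier) → List A → Carrier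
  ∑ f []       = 0#
  ∑ f (x ∷ xs) = f x + ∑ f xs

  ∑-cong : All (λ x → f x ≡ g x) xs → ∑ f xs ≡ ∑ g xs
  ∑-cong []        = refl
  ∑-cong (e ∷ es) = cong₂ _+_ e (∑-cong es)

  ∑-mono : All (λ x → f x ≤ g x) xs → ∑ f xs ≤ ∑ g xs
  ∑-mono []        = ≤-refl
  ∑-mono (h ∷ hs) = +-mono-≤ h (∑-mono hs)

  ∑-++ : ∀ (f : A → Carrier) xs ys → ∑ f (xs ++ ys) ≡ ∑ f xs + ∑ f ys
  ∑-++ f []       ys = sym (+-identityˡ _)
  ∑-++ f (x ∷ xs) ys = trans (cong (f x +_) (∑-++ f xs ys)) (sym (+-assoc _ _ _))

  ∑-↭ : ∀ (f : A → Carrier) → xs ↭ ys → ∑ f xs ≡ ∑ f ys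
  ∑-↭ f Perm.refl         = refl
  ∑-↭ f (Perm.prep x p)   = cong (f x +_) (∑-↭ f p)
  ∑-↭ f (Perm.swap x y p) = trans (cong (λ s → f x + (f y + s)) (∑-↭ f p)) (x∙yz≈y∙xz _ _ _)
  ∑-↭ f (Perm.trans p q)  = trans (∑-↭ f p) (∑-↭ f q)

  ∑-tabulate : ∀ (f : A → Carrier) {n} (g : Fin n → A) → ∑ f (tabulate g) ≡ sum (f ∘ g)
  ∑-tabulate f {zero}  g = refl
  ∑-tabulate f {suc n} g = cong (f (g Fin.zero) +_) (∑-tabulate f (g ∘ Fin.suc))

  ∑-const : ∀ {d} → All (λ x → f x ≡ g x + d) xs → ∑ f xs ≡ ∑ g xs + length xs · d
  ∑-const []       = sym (+-identityʳ 0#)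
  ∑-const (e ∷ es) = trans (cong₂ _+_ e (∑-const es)) (interchange _ _ _ _)

  -- The total weight of all elements with at least m elements below them, when the
  -- head of the list is on top.
  excess : (A → Carrier) → ℕ → List A → Carrier
  excess w m []       = 0#
  excess w m (x ∷ xs) with m ℕ.≤? length xs
  ... | yes _ = w x + excess w m xs
  ... | no  _ = 0#

  module _ {w : A → Carrier} where

    excess-∷ : ∀ m x xs → m ℕ.≤ length xs → excess w m (x ∷ xs) ≡ w x + excess w m xs
    excess-∷ m x xs m≤ with m ℕ.≤? length xs
    ... | yes _  = refl
    ... | no  m≰ = contradiction m≤ m≰

    excess-short : ∀ m xs → length xs ℕ.≤ m → excess w m xs ≡ 0#
    excess-short m []       _  = refl
    excess-short m (_ ∷ xs) l< with m ℕ.≤? length xs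
    ... | yes m≤ = contradiction m≤ (ℕₚ.<⇒≱ l<)
    ... | no  _  = refl

    excess-cong : ∀ {v m xs} → All (λ x → w x ≡ v x) xs → excess w m xs ≡ excess v m xs
    excess-cong []       = refl
    excess-cong {m = m} {_ ∷ xs} (e ∷ es) with m ℕ.≤? length xs
    ... | yes _ = cong₂ _+_ e (excess-cong es)
    ... | no  _ = refl

    module _ (0≤w : ∀ x → 0# ≤ w x) where

      excess-nonNeg : ∀ m xs → 0# ≤ excess w m xs
      excess-nonNeg m []       = ≤-refl
      excess-nonNeg m (x ∷ xs) with m ℕ.≤? length xs
      ... | yes _ = 0≤x+y (0≤w x) (excess-nonNeg m xs)
      ... | no  _ = ≤-refl

      excess-∷-≤ : ∀ m x xs → excess w m (x ∷ xs) ≤ w x + excess w m xs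
      excess-∷-≤ m x xs with m ℕ.≤? length xs
      ... | yes _ = ≤-refl
      ... | no  _ = 0≤x+y (0≤w x) (excess-nonNeg m xs)

      excess-tail-≤ : ∀ m x xs → excess w m xs ≤ excess w m (x ∷ xs)
      excess-tail-≤ m x xs with m ℕ.≤? length xs
      ... | yes _  = x≤y+x (0≤w x)
      ... | no  m≰ = ≤-reflexive (excess-short m xs (ℕₚ.<⇒≤ (ℕₚ.≰⇒> m≰)))

      excess-antitone : ∀ {m k} xs → m ℕ.≤ k → excess w k xs ≤ excess w m xs
      excess-antitone         []       _   = ≤-refl
      excess-antitone {m} {k} (x ∷ xs) m≤k with k ℕ.≤? length xs
      ... | no  _  = excess-nonNeg m (x ∷ xs)
      ... | yes k≤ = subst₂ _≤_ refl (sym (excess-∷ m x xs (ℕₚ.≤-trans m≤k k≤)))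
                       (+-mono-≤ ≤-refl (excess-antitone xs m≤k))

      -- Raising the threshold from `m` to `suc m` discards a single element, the one with exactly
      -- `m` elements below it.
      excess-gap : ∀ {h m xs} → All (λ x → h ≤ w x) xs → m ℕ.< length xs →
                   h + excess w (suc m) xs ≤ excess w m xs
      excess-gap {h} {m} {x ∷ xs} (h≤x ∷ h≤xs) (s≤s m≤) = begin
        h + excess w (suc m) (x ∷ xs) ≤⟨ tail-gap (suc m ℕ.≤? length xs) ⟩
        w x + excess w m xs           ≡⟨ sym (excess-∷ m x xs m≤) ⟩
        excess w m (x ∷ xs)           ∎
        where
        tail-gap : _ → h + excess w (suc m) (x ∷ xs) ≤ w x + excess w m xs
        tail-gap (yes m<) = subst₂ _≤_
          (trans (x∙yz≈y∙xz (w x) h _) (cong (h +_) (sym (excess-∷ (suc m) x xs m<)))) refl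
          (+-mono-≤ ≤-refl (excess-gap h≤xs m<))
        tail-gap (no  m≮) = +-mono-≤ h≤x
          (subst₂ _≤_ (sym (excess-short (suc m) (x ∷ xs) (ℕₚ.≰⇒> m≮))) refl (excess-nonNeg m xs))

-- Integer powers of two and the size classes.

module PowersOfTwo (K : ArchimedeanOrderedField) where

  open ArchimedeanOrderedField K
  open BinaryLog K using (0≤1; 1≤2^n; pow-inverse; inverse-nonNeg)
  open OrderedField K
  open CommutativeRing commutativeRing
    using (*-comm; *-assoc; *-identityˡ; *-identityʳ; distribʳ)

  2*x≡x+x : ∀ x → 2# * x ≡ x + x
  2*x≡x+x x = trans (distribʳ x 1# 1#) (cong₂ _+_ (*-identityˡ x) (*-identityˡ x))

  -- Serves `2^-suc` at negative exponents: `1#` is expanded as `2# * a * (2# * a) ⁻¹`, after which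
  -- `a` cancels against `a ⁻¹`.
  halve-inverse : ∀ n → (2# ^ n) ⁻¹ ≡ 2# * (2# ^ suc n) ⁻¹
  halve-inverse n = begin-equality
    a ⁻¹                          ≡⟨ sym (*-identityˡ _) ⟩
    1# * a ⁻¹                     ≡⟨ cong (_* a ⁻¹) (sym (pow-inverse (suc n))) ⟩
    2# * a * (2# * a) ⁻¹ * a ⁻¹   ≡⟨ cong (_* a ⁻¹) (trans (*-assoc 2# a _) (trans (cong (2# *_) (*-comm a _)) (sym (*-assoc 2# _ a)))) ⟩
    2# * (2# * a) ⁻¹ * a * a ⁻¹   ≡⟨ *-assoc _ a (a ⁻¹) ⟩
    2# * (2# * a) ⁻¹ * (a * a ⁻¹) ≡⟨ cong (2# * (2# * a) ⁻¹ *_) (pow-inverse n) ⟩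
    2# * (2# * a) ⁻¹ * 1#         ≡⟨ *-identityʳ _ ⟩
    2# * (2# * a) ⁻¹              ∎
    where
    a = 2# ^ n

  2^-suc : ∀ i → 2^ (i ℤ.+ ℤ.+ 1) ≡ 2# * 2^ i
  2^-suc (ℤ.+ n)           = cong (2# ^_) (ℕₚ.+-comm n 1)
  2^-suc ℤ.-[1+ zero ]     = trans (sym (pow-inverse 1)) (cong (_* (2# ^ 1) ⁻¹) (*-identityʳ 2#))
  2^-suc ℤ.-[1+ suc n ]    = halve-inverse (suc n)

  0≤2^ : ∀ i → 0# ≤ 2^ i
  0≤2^ (ℤ.+ n)    = ≤-trans 0≤1 (1≤2^n n)
  0≤2^ ℤ.-[1+ n ] = inverse-nonNeg (≤-trans 0≤1 (1≤2^n (suc n))) (pow-inverse (suc n))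

  2^-mono-+ : ∀ i k → 2^ i ≤ 2^ (i ℤ.+ ℤ.+ k)
  2^-mono-+ i zero    = ≤-reflexive (cong 2^_ (sym (ℤₚ.+-identityʳ i)))
  2^-mono-+ i (suc k) = begin
    2^ i                          ≤⟨ x≤x+y (0≤2^ i) ⟩
    2^ i + 2^ i                   ≡⟨ sym (2*x≡x+x _) ⟩
    2# * 2^ i                     ≡⟨ sym (2^-suc i) ⟩
    2^ (i ℤ.+ ℤ.+ 1)              ≤⟨ 2^-mono-+ (i ℤ.+ ℤ.+ 1) k ⟩
    2^ (i ℤ.+ ℤ.+ 1 ℤ.+ ℤ.+ k)    ≡⟨ cong 2^_ (ℤₚ.+-assoc i (ℤ.+ 1) (ℤ.+ k)) ⟩
    2^ (i ℤ.+ ℤ.+ suc k)          ∎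

  2^-mono : ∀ {i j} → i ℤ.≤ j → 2^ i ≤ 2^ j
  2^-mono {i} {j} i≤j = subst (λ k → 2^ i ≤ 2^ k) i+[j-i]≡j (2^-mono-+ i ℤ.∣ j ℤ.- i ∣)
    where
    i+[j-i]≡j : i ℤ.+ ℤ.+ ℤ.∣ j ℤ.- i ∣ ≡ j
    i+[j-i]≡j = trans (cong (λ k → i ℤ.+ k) (ℤₚ.0≤i⇒+∣i∣≡i (ℤₚ.i≤j⇒0≤j-i i≤j)))
      (trans (ℤₚ.+-comm i (j ℤ.- i))
        (trans (ℤₚ.+-assoc j (ℤ.- i) i)
          (trans (cong (λ k → j ℤ.+ k) (ℤₚ.+-inverseˡ i)) (ℤₚ.+-identityʳ j))))

  -- For integers, `i < j` means `i + 1 ≤ j`, so the smaller power is at most half of the larger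
  -- one.
  2^-gap : ∀ i j → ¬ 2# * 2^ i ≤ 2^ j → 2^ j ≤ 2^ i
  2^-gap i j 2·2^i≰2^j with j ℤ.≤? i
  ... | yes j≤i = 2^-mono j≤i
  ... | no  j≰i = contradiction
    (subst (_≤ 2^ j) (trans (cong 2^_ (ℤₚ.+-comm (ℤ.+ 1) i)) (2^-suc i))
      (2^-mono (ℤₚ.i<j⇒suc[i]≤j (ℤₚ.≰⇒> j≰i))))
    2·2^i≰2^j

-- The interface between the base-2 classes and the analysis. `p̃-gap` expresses that predictions
-- live on a scale of ratio two: a prediction exceeding half of another one is at least as large.
record Classes (K : ArchimedeanOrderedField) {n}
               (size p̃ : Fin n → ArchimedeanOrderedField.Carrier K) : Set where
  open ArchimedeanOrderedField K
  field
    0≤p̃     : ∀ q → 0# ≤ p̃ q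
    p̃≤size  : ∀ q → p̃ q ≤ size q
    size≤2p̃ : ∀ q → size q ≤ 2# * p̃ q
    p̃-gap   : ∀ x q → ¬ 2# * p̃ x ≤ p̃ q → p̃ q ≤ p̃ x

-- Order and weight of the full bin.

module FullBin (K : ArchimedeanOrderedField) {n}
               {size p̃ : Fin n → ArchimedeanOrderedField.Carrier K}
               (classes : Classes K size p̃) where

  open ArchimedeanOrderedField K
  open BinaryLog K using (0≤1; *-monoʳ-≤)
  open OrderedField K
  open Sums K
  open PowersOfTwo K using (2*x≡x+x)
  open Scheduling K
  open Classes classes
  open Bins 2# p̃

  Sorted : Bin n → Set
  Sorted = AllPairs (λ x y → p̃ x ≤ p̃ y)

  -- The form that `uponJobRelease` takes on a sorted bin: the violations with `q` then form a
  -- prefix, and `q` sinks just below it.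
  insert : Fin n → Bin n → Bin n
  insert q []       = [ q ]
  insert q (x ∷ xs) with 2# * p̃ x ≤? p̃ q
  ... | yes _ = x ∷ insert q xs
  ... | no  _ = q ∷ x ∷ xs

  ≰-upward : ∀ {q x xs} → All (λ y → p̃ x ≤ p̃ y) xs → ¬ 2# * p̃ x ≤ p̃ q →
             All (λ y → ¬ 2# * p̃ y ≤ p̃ q) xs
  ≰-upward x≤xs x≰ = All.map (λ x≤y y≤ → x≰ (≤-trans (*-monoʳ-≤ (≤-trans 0≤1 (x≤x+y 0≤1)) x≤y) y≤)) x≤xs

  -- The position of the violating job `y` receives the next violating job, which then takes over
  -- the role of `y`. The position of the last one receives `q`, and the list of replacements is
  -- used up.
  refill-insert : ∀ {q y} xs → Sorted xs → 2# * p̃ y ≤ p̃ q →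
    refill q (filter (λ x → 2# * p̃ x ≤? p̃ q) xs ++ [ q ]) (y ∷ xs) ≡ insert q xs
  refill-insert {q} {y} [] _ y≤ with 2# * p̃ y ≤? p̃ q
  ... | yes _  = refl
  ... | no  y≰ = contradiction y≤ y≰
  refill-insert {q} {y} (x ∷ xs) (x≤xs ∷ sorted) y≤ with 2# * p̃ x ≤? p̃ q
  ... | yes x≤ with 2# * p̃ y ≤? p̃ q
  ...   | yes _  = cong (x ∷_) (refill-insert xs sorted x≤)
  ...   | no  y≰ = contradiction y≤ y≰
  refill-insert {q} {y} (x ∷ xs) (x≤xs ∷ sorted) y≤ | no x≰
    rewrite filter-none (λ x → 2# * p̃ x ≤? p̃ q) (≰-upward x≤xs x≰)
    with 2# * p̃ y ≤? p̃ q
  ... | yes _  = refl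
  ... | no  y≰ = contradiction y≤ y≰

  uponJobRelease-insert : ∀ q F → Sorted F → uponJobRelease q F ≡ insert q F
  uponJobRelease-insert q []       _ = refl
  uponJobRelease-insert q (x ∷ xs) (x≤xs ∷ sorted) with 2# * p̃ x ≤? p̃ q
  ... | yes x≤ = cong (x ∷_) (refill-insert xs sorted x≤)
  ... | no  x≰ rewrite filter-none (λ x → 2# * p̃ x ≤? p̃ q) (≰-upward x≤xs x≰) = refl

  insert-↭ : ∀ q F → insert q F ↭ q ∷ F
  insert-↭ q []       = Perm.refl
  insert-↭ q (x ∷ xs) with 2# * p̃ x ≤? p̃ q
  ... | yes _ = Perm.trans (Perm.prep x (insert-↭ q xs)) (Perm.swap x q Perm.refl)
  ... | no  _ = Perm.refl

  insert-sorted : ∀ q {F} → Sorted F → Sorted (insert q F)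
  insert-sorted q {[]}     []              = [] ∷ []
  insert-sorted q {x ∷ xs} (x≤xs ∷ sorted) with 2# * p̃ x ≤? p̃ q
  ... | yes x≤ = All-resp-↭ (Perm.↭-sym (insert-↭ q xs)) (x≤q ∷ x≤xs) ∷ insert-sorted q sorted
    where
    x≤q = ≤-trans (x≤x+y (0≤p̃ x)) (subst (_≤ p̃ q) (2*x≡x+x _) x≤)
  ... | no  x≰ = (q≤x ∷ All.map (≤-trans q≤x) x≤xs) ∷ x≤xs ∷ sorted
    where
    q≤x = p̃-gap x q x≰

  0≤size : ∀ q → 0# ≤ size q
  0≤size q = ≤-trans (0≤p̃ q) (p̃≤size q)

  -- Each job above `q` gains one job beneath it, so one of them may become counted in place of `q`.
  -- It is of smaller class, hence weighs at most `size q`.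
  excess-insert : ∀ m q F → excess size m (insert q F) ≤ size q + excess size m F
  excess-insert m q []       = excess-∷-≤ 0≤size m q []
  excess-insert m q (x ∷ xs) with 2# * p̃ x ≤? p̃ q
  ... | no  _  = excess-∷-≤ 0≤size m q (x ∷ xs)
  ... | yes x≤ with m ℕ.≤? length xs
  ...   | yes m≤ = begin
    excess size m (x ∷ insert q xs)       ≤⟨ excess-∷-≤ 0≤size m x (insert q xs) ⟩
    size x + excess size m (insert q xs)  ≤⟨ +-mono-≤ ≤-refl (excess-insert m q xs) ⟩
    size x + (size q + excess size m xs)  ≡⟨ x∙yz≈y∙xz _ _ _ ⟩
    size q + (size x + excess size m xs)  ∎
  ...   | no  m≰ = begin
    excess size m (x ∷ insert q xs)       ≤⟨ excess-∷-≤ 0≤size m x (insert q xs) ⟩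
    size x + excess size m (insert q xs)  ≡⟨ cong (size x +_) (excess-short m (insert q xs) short) ⟩
    size x + 0#                           ≤⟨ +-mono-≤ (≤-trans (size≤2p̃ x) (≤-trans x≤ (p̃≤size q))) ≤-refl ⟩
    size q + 0#                           ∎
    where
    short : length (insert q xs) ℕ.≤ m
    short = subst (ℕ._≤ m) (sym (↭-length (insert-↭ q xs))) (ℕₚ.≰⇒> m≰)

  -- A job placed above both of the elements that leave the counted part weighs at
  -- most as much as these two together, being of no larger class.
  excess-insert-shift : ∀ m q F → Sorted F →
    excess size (2 ℕ.+ m) (insert q F) ≤ excess size m F
  excess-insert-shift m q []       _ = ≤-refl
  excess-insert-shift m q (x ∷ xs) (x≤xs ∷ sorted) with 2# * p̃ x ≤? p̃ q
  ... | yes _ with 2 ℕ.+ m ℕ.≤? length (insert q xs)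
  ...   | no  _  = excess-nonNeg 0≤size m (x ∷ xs)
  ...   | yes m< = begin
    size x + excess size (2 ℕ.+ m) (insert q xs) ≤⟨ +-mono-≤ ≤-refl (excess-insert-shift m q xs sorted) ⟩
    size x + excess size m xs                    ≡⟨ sym (excess-∷ m x xs m≤) ⟩
    excess size m (x ∷ xs)                       ∎
    where
    m≤ : m ℕ.≤ length xs
    m≤ = ℕₚ.<⇒≤ (ℕₚ.≤-pred (subst (2 ℕ.+ m ℕ.≤_) (↭-length (insert-↭ q xs)) m<))
  excess-insert-shift m q (x ∷ xs) (x≤xs ∷ sorted) | no x≰
    with 2 ℕ.+ m ℕ.≤? length (x ∷ xs)
  ... | no  _  = excess-nonNeg 0≤size m (x ∷ xs)
  ... | yes m< = begin
    size q + excess size (2 ℕ.+ m) (x ∷ xs)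
      ≤⟨ +-mono-≤ (subst (size q ≤_) (2*x≡x+x _) (size≤2p̃ q)) ≤-refl ⟩
    p̃ q + p̃ q + excess size (2 ℕ.+ m) (x ∷ xs)
      ≡⟨ +-assoc _ _ _ ⟩
    p̃ q + (p̃ q + excess size (2 ℕ.+ m) (x ∷ xs))
      ≤⟨ +-mono-≤ ≤-refl (excess-gap 0≤size p̃q≤F m<) ⟩
    p̃ q + excess size (suc m) (x ∷ xs)
      ≤⟨ excess-gap 0≤size p̃q≤F (ℕₚ.<⇒≤ m<) ⟩
    excess size m (x ∷ xs)                       ∎
    where
    q≤x : p̃ q ≤ p̃ x
    q≤x = p̃-gap x q x≰

    p̃q≤F : All (λ y → p̃ q ≤ size y) (x ∷ xs)
    p̃q≤F = All.map (λ {y} h → ≤-trans h (p̃≤size y)) (q≤x ∷ All.map (≤-trans q≤x) x≤xs)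

-- Volume processed by an arbitrary feasible schedule.

module FeasibleSchedule (K : ArchimedeanOrderedField) {n}
  {Q : Scheduling.Input K n} {S : Scheduling.Schedule K n}
  (feasible : Scheduling.Feasible K Q S) where

  open ArchimedeanOrderedField K
  open OrderedField K
  open Sums K
  open Scheduling K
  open Feasible feasible

  private variable
    q   : Fin n
    t u : Carrier

  work : Slice n → Carrier → Carrier
  work s t = 0# ⊔ (t ⊓ stop s - start s)

  0≤work : ∀ s t → 0# ≤ work s t
  0≤work s t = x≤x⊔y 0# _

  work-mono : ∀ s → t ≤ u → work s t ≤ work s u
  work-mono s t≤u = ⊔-monoʳ-≤ 0# (+-mono-≤ (⊓-monoˡ-≤ (stop s) t≤u) ≤-refl)

  work-early : ∀ s → t ≤ start s → work s t ≡ 0#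
  work-early {t} s t≤start = x≥y⇒x⊔y≈x
    (subst₂ _≤_ refl (-‿inverseʳ (start s)) (+-mono-≤ (≤-trans (x⊓y≤x t (stop s)) t≤start) ≤-refl))

  work-late : ∀ s → stop s ≤ t → stop s ≤ u → work s t ≡ work s u
  work-late s stop≤t stop≤u =
    cong (λ x → 0# ⊔ (x - start s)) (trans (x≥y⇒x⊓y≈y stop≤t) (sym (x≥y⇒x⊓y≈y stop≤u)))

  -- The unit rate of the machine, with the times added crosswise instead of subtracted, so that
  -- bounds for adjacent intervals can be summed and the common time cancelled.
  work-rate : ∀ s → t ≤ u → work s u + t ≤ work s t + u
  work-rate {t} {u} s t≤u = subst₂ _≤_ refl
    (trans (+-assoc _ _ t) (cong (work s t +_) (x-y+y≡x u t)))
    (+-mono-≤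
      (⊔-lub (0≤x+y (0≤work s t) (x≤y⇒0≤y-x t≤u))
             (≤-trans (cut (total t b)) (+-mono-≤ (x≤y⊔x 0# _) ≤-refl)))
      ≤-refl)
    where
    a = start s
    b = stop s

    telescope : t - a + (u - t) ≡ u - a
    telescope = trans (+-comm _ _) (trans (sym (+-assoc _ _ _)) (cong (_- a) (x-y+y≡x u t)))

    cut : t ≤ b ⊎ b ≤ t → u ⊓ b - a ≤ t ⊓ b - a + (u - t)
    cut (inj₁ t≤b) = begin
      u ⊓ b - a             ≤⟨ +-mono-≤ (x⊓y≤x u b) ≤-refl ⟩
      u - a                 ≡⟨ sym telescope ⟩
      t - a + (u - t)       ≡⟨ cong (λ x → x - a + (u - t)) (sym (x≤y⇒x⊓y≈x t≤b)) ⟩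
      t ⊓ b - a + (u - t)   ∎
    cut (inj₂ b≤t) = begin
      u ⊓ b - a             ≤⟨ +-mono-≤ (x⊓y≤y u b) ≤-refl ⟩
      b - a                 ≤⟨ x≤x+y (x≤y⇒0≤y-x t≤u) ⟩
      b - a + (u - t)       ≡⟨ cong (λ x → x - a + (u - t)) (sym (x≥y⇒x⊓y≈y b≤t)) ⟩
      t ⊓ b - a + (u - t)   ∎

  received-mono : ∀ ss → t ≤ u → received ss q t ≤ received ss q u
  received-mono         []       t≤u = ≤-refl
  received-mono {q = q} (s ∷ ss) t≤u with job s ≟ q
  ... | yes _ = +-mono-≤ (work-mono s t≤u) (received-mono ss t≤u)
  ... | no  _ = received-mono ss t≤u

  -- The hypothesis concerns the slices of `q` alone, so it can come from the release time of `q` as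
  -- well as from a time preceding all slices.
  received-early : ∀ {ss : List (Slice n)} → All (λ s → job s ≡ q → t ≤ start s) ss → received ss q t ≡ 0#
  received-early                  []       = refl
  received-early {q} {ss = s ∷ _} (h ∷ hs) with job s ≟ q
  ... | yes e = trans (cong₂ _+_ (work-early s (h e)) (received-early hs)) (+-identityʳ 0#)
  ... | no  _ = received-early hs

  received-late : ∀ {ss : List (Slice n)} → All (λ s → job s ≡ q → stop s ≤ t × stop s ≤ u) ss →
                  received ss q t ≡ received ss q u
  received-late                  []       = refl
  received-late {q} {ss = s ∷ _} (h ∷ hs) with job s ≟ q
  ... | yes e = cong₂ _+_ (work-late s (proj₁ (h e)) (proj₂ (h e))) (received-late hs)
  ... | no  _ = received-late hs

  received-skip : ∀ (s : Slice n) ss {T} → All (job s ≢_) T →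
                  ∑ (λ q → received (s ∷ ss) q t) T ≡ ∑ (λ q → received ss q t) T
  received-skip         s ss         []       = refl
  received-skip {t = t} s ss {q ∷ _} (h ∷ hs) with job s ≟ q
  ... | yes e = contradiction e h
  ... | no  _ = cong (received ss q t +_) (received-skip s ss hs)

  -- As `T` has no repetitions, the slice belongs to at most one of its jobs. The alternative
  -- depends on `s` and `T` but not on the time, so the same one holds at both ends of an interval.
  received-∷ : ∀ s ss {T} → AllPairs _≢_ T →
    (∀ t → ∑ (λ q → received (s ∷ ss) q t) T ≡ ∑ (λ q → received ss q t) T) ⊎
    (∀ t → ∑ (λ q → received (s ∷ ss) q t) T ≡ work s t + ∑ (λ q → received ss q t) T)
  received-∷ s ss         []              = inj₁ λ _ → refl
  received-∷ s ss {q ∷ T} (q∉T ∷ unique) with job s ≟ q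
  ... | yes refl = inj₂ λ t →
    trans (cong (work s t + received ss q t +_) (received-skip s ss q∉T)) (+-assoc _ _ _)
  ... | no  _ with received-∷ s ss unique
  ...   | inj₁ h = inj₁ λ t → cong (received ss q t +_) (h t)
  ...   | inj₂ h = inj₂ λ t → trans (cong (received ss q t +_) (h t)) (x∙yz≈y∙xz _ _ _)

  -- The slices are chronological: until the first one stops, the later ones contribute nothing, and
  -- from then on the first one contributes a constant.
  received-rate-≤ : ∀ {ss : List (Slice n)} {T} → AllPairs (λ s s′ → stop s ≤ start s′) ss → AllPairs _≢_ T →
    t ≤ u → ∑ (λ q → received ss q u) T + t ≤ ∑ (λ q → received ss q t) T + u
  received-rate-≤ {T = T} [] _ t≤u = +-mono-≤ ≤-refl t≤u
  received-rate-≤ {t} {u} {s ∷ ss} {T} (s≤ss ∷ disjoint) unique t≤u with received-∷ s ss unique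
  ... | inj₁ same rewrite same t | same u = received-rate-≤ disjoint unique t≤u
  ... | inj₂ more rewrite more t | more u = bound (total t b) (total u b)
    where
    b = stop s

    A : Carrier → Carrier
    A x = ∑ (λ q → received ss q x) T

    A-early : ∀ {x} → x ≤ b → A x ≡ A b
    A-early x≤b = ∑-cong (All.universal (λ q → trans (early x≤b) (sym (early ≤-refl))) T)
      where
      early : ∀ {x q} → x ≤ b → received ss q x ≡ 0#
      early x≤b = received-early (All.map (λ b≤ _ → ≤-trans x≤b b≤) s≤ss)

    bound : t ≤ b ⊎ b ≤ t → u ≤ b ⊎ b ≤ u → work s u + A u + t ≤ work s t + A t + u
    bound _ (inj₁ u≤b) rewrite A-early u≤b | A-early (≤-trans t≤u u≤b) = subst₂ _≤_
      (xy∙z≈xz∙y _ _ _) (xy∙z≈xz∙y _ _ _) (+-mono-≤ (work-rate s t≤u) (≤-refl {A b}))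
    bound (inj₂ b≤t) (inj₂ b≤u) rewrite work-late s b≤u b≤t = subst₂ _≤_
      (sym (+-assoc _ _ _)) (sym (+-assoc _ _ _))
      (+-mono-≤ (≤-refl {work s t}) (received-rate-≤ disjoint unique t≤u))
    -- The interval is cut at `b`: the first slice accounts for the time before `b` and the later
    -- slices for the time after it.
    bound (inj₁ t≤b) (inj₂ b≤u) rewrite work-late s b≤u ≤-refl | A-early t≤b = +-cancelʳ-≤ b
      (subst₂ _≤_
        (trans (interchange _ _ _ _) (sym (+-assoc _ _ _)))
        (trans (interchange _ _ _ _) (trans (cong (work s t + A b +_) (+-comm b u)) (sym (+-assoc _ _ _))))
        (+-mono-≤ (work-rate s t≤b) (received-rate-≤ disjoint unique b≤u)))

  done : Fin n → Carrier → Carrier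
  done = received (slices S)

  done-rate : ∀ {T} → AllPairs _≢_ T → t ≤ u →
              ∑ (λ q → done q u) T + t ≤ ∑ (λ q → done q t) T + u
  done-rate = received-rate-≤ disjoint

  done-release : t ≤ release (Q q) → done q t ≡ 0#
  done-release t≤r = received-early (All.map (λ { r≤ refl → ≤-trans t≤r r≤ }) released)

  done-completed : completion S q ≤ t → done q t ≡ processing (Q q)
  done-completed {q} c≤t = trans
    (received-late (All.map (λ { stop≤ refl → ≤-trans stop≤ c≤t , stop≤ }) uncompleted))
    (completed q)

  done≤processing : ∀ q t → done q t ≤ processing (Q q)
  done≤processing q t with total t (completion S q)
  ... | inj₁ t≤c = subst (done q t ≤_) (completed q) (received-mono (slices S) t≤c)
  ... | inj₂ c≤t = ≤-reflexive (done-completed c≤t)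

  -- A job completed by its release time would have received nothing, whereas its processing time is
  -- positive.
  release≤completion : ∀ q → release (Q q) ≤ completion S q
  release≤completion q with total (release (Q q)) (completion S q)
  ... | inj₁ r≤c = r≤c
  ... | inj₂ c≤r = contradiction
    (trans (sym (done-release c≤r)) (completed q))
    (proj₂ (processing>0 (Q q)))

-- Accrued costs and the invariant.

module TwoBinAnalysis (K : ArchimedeanOrderedField) {n}
  {Q : Scheduling.Input K n} {S : Scheduling.Schedule K n}
  (feasible : Scheduling.Feasible K Q S)
  {p̃ : Fin n → ArchimedeanOrderedField.Carrier K}
  (classes : Classes K (λ q → Scheduling.processing (Q q)) p̃) where

  open ArchimedeanOrderedField K
  open OrderedField K
  open Sums K
  open FullBin K classes
  open Scheduling K
  open FeasibleSchedule K feasible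
  open Bins 2# p̃
  open TwoBin Q 2# p̃
  open CommutativeMonoidSolver +-commutativeMonoid using (solve; _⊕_; _⊜_)

  c* : Fin n → Carrier
  c* = completion S

  size r : Fin n → Carrier
  size q = processing (Q q)
  r q    = release (Q q)

  -- The flow time accrued up to time `t`, by the algorithm here and by `S` in `offlineCost`. Each
  -- grows at a rate equal to the number of released unfinished jobs; following both from event to
  -- event replaces the integration over time.
  onlineCost : Carrier → List (Fin n) → Vector Carrier n → List (Fin n) → Carrier
  onlineCost t pending c D = ∑ (λ q → t - r q) pending + ∑ (λ q → c q - r q) D

  offlineCost : Carrier → List (Fin n) → Carrier
  offlineCost t R = ∑ (λ q → t ⊓ c* q - r q) R

  private variable
    t t′      : Carrier
    U F P R D : List (Fin n)
    A B       : List (Fin n)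
    rem rem′ c : Vector Carrier n
    j q       : Fin n

  -- R are the released and D the completed jobs. In `key`, a set A of a released
  -- jobs is compared with the 2a jobs of lowest priority in each bin: what remains
  -- of the other jobs of the algorithm is at most what remains of the other
  -- released jobs (B) in the schedule S.
  record Invariant (t : Carrier) (U F P : List (Fin n)) (rem c : Vector Carrier n)
                   (R D : List (Fin n)) : Set where
    field
      jobs       : P ++ ((U ++ F) ++ D) ↭ allFin n
      releases   : U ++ R ↭ allFin n
      chronology : AllPairs (λ p q → r p ≤ r q) U
      future     : All (λ q → t ≤ r q) U
      sorted     : Sorted F
      fresh      : All (λ q → rem q ≡ size q) (U ++ F)
      0≤rem      : ∀ q → 0# ≤ rem q
      key        : ∀ {A B} → Interleaving A B R →
                   excess size (2 ℕ.* length A) F + excess rem (2 ℕ.* length A) P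
                     + ∑ (λ q → done q t) B ≤ ∑ size B
      ledger     : onlineCost t (F ++ P) c D ≤ 4 · offlineCost t R

  open Invariant

  ≢-sym-All : ∀ {xs : List (Fin n)} → All (j ≢_) xs → All (λ q → q ≢ j) xs
  ≢-sym-All = All.map λ j≢q q≡j → j≢q (sym q≡j)

  unique-↭ : ∀ {xs} → xs ↭ allFin n → AllPairs _≢_ xs
  unique-↭ p = Unique-resp-↭ (setoid (Fin n)) (Perm.↭⇒↭ₛ (Perm.↭-sym p)) (allFin⁺ n)

  AllPairs-++⁻ʳ : ∀ {ℓ} {T : Fin n → Fin n → Set ℓ} xs {ys} → AllPairs T (xs ++ ys) → AllPairs T ys
  AllPairs-++⁻ʳ []       h       = h
  AllPairs-++⁻ʳ (x ∷ xs) (_ ∷ h) = AllPairs-++⁻ʳ xs h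

  -- In `jobs` the partial bin comes first, so `j` heads a list without repetitions. Updates at `j`
  -- therefore leave the data of the other jobs unchanged.
  top-unique : Invariant t U F (j ∷ P) rem c R D →
               All (j ≢_) P × All (j ≢_) (U ++ F) × All (j ≢_) D
  top-unique {U = U} {F} {P = P} I with unique-↭ (jobs I)
  ... | j∉ ∷ _ = let j∉P , j∉rest = Allₚ.++⁻ P j∉ in j∉P , Allₚ.++⁻ (U ++ F) j∉rest

  right-unique : Interleaving A B R → AllPairs _≢_ R → AllPairs _≢_ B
  right-unique {A} i unique =
    AllPairs-++⁻ʳ A (Unique-resp-↭ (setoid (Fin n)) (Perm.↭⇒↭ₛ (toPermutation i)) unique)

  -- The passage of time between events.

  offlineCost-mono : t ≤ t′ → ∀ R → offlineCost t R ≤ offlineCost t′ R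
  offlineCost-mono t≤t′ R = ∑-mono (All.universal (λ q → +-mono-≤ (⊓-monoˡ-≤ (c* q) t≤t′) ≤-refl) R)

  elapse : ∀ t t′ x → t′ - x ≡ (t - x) + (t′ - t)
  elapse t t′ x = trans (cong (_- x) (sym (x-y+y≡x t′ t)))
    (solve 3 (λ d t x → (d ⊕ t) ⊕ x ⊜ (t ⊕ x) ⊕ d) refl (t′ - t) t (- x))

  -- The jobs of `A` are unfinished in `S` throughout the interval, so each accrues its full length;
  -- the other terms do not decrease.
  offlineCost-advance : t ≤ t′ → Interleaving A B R → All (λ q → t′ ≤ c* q) A →
    offlineCost t R + length A · (t′ - t) ≤ offlineCost t′ R
  offlineCost-advance t≤t′ [] [] = ≤-reflexive (+-identityʳ 0#)
  offlineCost-advance {t} {t′} {A = q ∷ A} {R = _ ∷ R} t≤t′ (consˡ i) (t′≤c* ∷ h) = begin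
    (t ⊓ c* q - r q + offlineCost t R) + (t′ - t + length A · (t′ - t))
      ≡⟨ interchange _ _ _ _ ⟩
    (t ⊓ c* q - r q + (t′ - t)) + (offlineCost t R + length A · (t′ - t))
      ≤⟨ +-mono-≤ (≤-reflexive alive) (offlineCost-advance t≤t′ i h) ⟩
    t′ ⊓ c* q - r q + offlineCost t′ R ∎
    where
    alive : t ⊓ c* q - r q + (t′ - t) ≡ t′ ⊓ c* q - r q
    alive rewrite x≤y⇒x⊓y≈x t′≤c* | x≤y⇒x⊓y≈x (≤-trans t≤t′ t′≤c*) = sym (elapse t t′ (r q))
  offlineCost-advance {t} {t′} {A} {R = q ∷ R} t≤t′ (consʳ i) h = begin
    (t ⊓ c* q - r q + offlineCost t R) + length A · (t′ - t)
      ≡⟨ +-assoc _ _ _ ⟩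
    t ⊓ c* q - r q + (offlineCost t R + length A · (t′ - t))
      ≤⟨ +-mono-≤ (+-mono-≤ (⊓-monoˡ-≤ (c* q) t≤t′) ≤-refl) (offlineCost-advance t≤t′ i h) ⟩
    t′ ⊓ c* q - r q + offlineCost t′ R ∎

  -- Here `u` is the latest completion time in `B`, or `t` if that is later. As `u` lies strictly
  -- before `t′`, the interval need not be cut at the completions of `S`: all of it is charged to
  -- the jobs that survive until `t′`.
  split : t ≤ t′ → ¬ t′ ≤ t → ∀ R → ∃₂ λ A B → Interleaving A B R × All (λ q → t′ ≤ c* q) A ×
    ∃ λ u → t ≤ u × ¬ t′ ≤ u × All (λ q → c* q ≤ u) B
  split {t} t≤t′ t′≰t [] = [] , [] , [] , [] , t , ≤-refl , t′≰t , []
  split {t} {t′} t≤t′ t′≰t (q ∷ R) with split t≤t′ t′≰t R | t′ ≤? c* q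
  ... | A , B , i , hA , u , t≤u , t′≰u , hB | yes t′≤c* =
    q ∷ A , B , consˡ i , t′≤c* ∷ hA , u , t≤u , t′≰u , hB
  ... | A , B , i , hA , u , t≤u , t′≰u , hB | no  t′≰c* =
    A , q ∷ B , consʳ i , hA , u ⊔ c* q , ≤-trans t≤u (x≤x⊔y u _) , ≰⊔ (total u (c* q)) ,
    x≤y⊔x u _ ∷ All.map (λ h → ≤-trans h (x≤x⊔y u _)) hB
    where
    ≰⊔ : u ≤ c* q ⊎ c* q ≤ u → ¬ t′ ≤ u ⊔ c* q
    ≰⊔ (inj₁ u≤c*) h = t′≰c* (subst (t′ ≤_) (x≤y⇒x⊔y≈y u≤c*) h)
    ≰⊔ (inj₂ c*≤u) h = t′≰u (subst (t′ ≤_) (x≥y⇒x⊔y≈x c*≤u) h)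

  -- If the partial bin had more than 2a jobs, then the job on top would have no more
  -- work left than S does between t and u on jobs that S completes before t′.
  partial-bound : ∀ {u} → Invariant t U F (j ∷ P) rem c R D → Interleaving A B R →
    t ≤ u → ¬ t′ ≤ u → t′ ≤ t + rem j → All (λ q → c* q ≤ u) B →
    length (j ∷ P) ℕ.≤ 2 ℕ.* length A
  partial-bound {t} {U} {F} {j} {P} {rem} {A = A} {B} {t′} {u} I i t≤u t′≰u t′≤ c*≤u = ℕₚ.≮⇒≥ λ 2a<|P| →
    t′≰u (≤-trans t′≤ (+-cancelʳ-≤ (∑ (λ q → done q t) B) (begin
      t + rem j + ∑ (λ q → done q t) B
        ≡⟨ +-assoc _ _ _ ⟩
      t + (rem j + ∑ (λ q → done q t) B)
        ≤⟨ +-mono-≤ ≤-refl (≤-trans (+-mono-≤ (top≤ (ℕₚ.≤-pred 2a<|P|)) ≤-refl) (key I i)) ⟩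
      t + ∑ size B
        ≡⟨ cong (t +_) (sym (∑-cong (All.map done-completed c*≤u))) ⟩
      t + ∑ (λ q → done q u) B
        ≡⟨ +-comm _ _ ⟩
      ∑ (λ q → done q u) B + t
        ≤⟨ done-rate (right-unique i (AllPairs-++⁻ʳ U (unique-↭ (releases I)))) t≤u ⟩
      ∑ (λ q → done q t) B + u
        ≡⟨ +-comm _ _ ⟩
      u + ∑ (λ q → done q t) B ∎)))
    where
    m = 2 ℕ.* length A

    top≤ : m ℕ.≤ length P → rem j ≤ excess size m F + excess rem m (j ∷ P)
    top≤ m≤ = begin
      rem j                                   ≤⟨ x≤x+y (excess-nonNeg (0≤rem I) m P) ⟩
      rem j + excess rem m P                  ≡⟨ sym (excess-∷ m j P m≤) ⟩
      excess rem m (j ∷ P)                    ≤⟨ x≤y+x (excess-nonNeg 0≤size m F) ⟩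
      excess size m F + excess rem m (j ∷ P)  ∎

  onlineCost-advance : ∀ t t′ pending c D →
    onlineCost t′ pending c D ≡ onlineCost t pending c D + length pending · (t′ - t)
  onlineCost-advance t t′ pending c D = trans
    (cong (_+ _) (∑-const (All.universal (λ q → elapse t t′ (r q)) pending)))
    (xy∙z≈xz∙y _ _ _)

  -- The bins do not change during the interval. With a jobs in `A`, each bin has at most 2a jobs,
  -- so the algorithm accrues cost at rate at most 4a, and `S` on average at rate at least a.
  ledger-advance : Invariant t U F (j ∷ P) rem c R D → length F ℕ.≤ length (j ∷ P) →
    t ≤ t′ → t′ ≤ t + rem j → onlineCost t′ (F ++ j ∷ P) c D ≤ 4 · offlineCost t′ R
  ledger-advance {t} {F = F} {j} {P} {c = c} {R = R} {D} {t′} I F≤P t≤t′ t′≤ with t′ ≤? t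
  -- An interval of length zero has no room for a `u` strictly before `t′`.
  ... | yes t′≤t = subst (λ x → onlineCost x (F ++ j ∷ P) c D ≤ 4 · offlineCost x R)
                     (≤-antisym t≤t′ t′≤t) (ledger I)
  ... | no  t′≰t with split t≤t′ t′≰t R
  ...   | A , B , i , t′≤c* , u , t≤u , t′≰u , c*≤u = begin
    onlineCost t′ (F ++ j ∷ P) c D
      ≡⟨ onlineCost-advance t t′ (F ++ j ∷ P) c D ⟩
    onlineCost t (F ++ j ∷ P) c D + length (F ++ j ∷ P) · d
      ≤⟨ +-mono-≤ (ledger I) (·-monoˡ-≤ (x≤y⇒0≤y-x t≤t′) pending≤4a) ⟩
    4 · offlineCost t R + (4 ℕ.* length A) · d
      ≡⟨ cong (_ +_) (sym (·-assocˡ d 4 (length A))) ⟩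
    4 · offlineCost t R + 4 · (length A · d)
      ≡⟨ sym (·-distrib-+ _ _ 4) ⟩
    4 · (offlineCost t R + length A · d)
      ≤⟨ ·-monoʳ-≤ 4 (offlineCost-advance t≤t′ i t′≤c*) ⟩
    4 · offlineCost t′ R ∎
    where
    d = t′ - t

    P≤2a : length (j ∷ P) ℕ.≤ 2 ℕ.* length A
    P≤2a = partial-bound I i t≤u t′≰u t′≤ c*≤u

    pending≤4a : length (F ++ j ∷ P) ℕ.≤ 4 ℕ.* length A
    pending≤4a = subst₂ ℕ._≤_ (sym (length-++ F))
      (sym (ℕₚ.*-distribʳ-+ (length A) 2 2))
      (ℕₚ.+-mono-≤ (ℕₚ.≤-trans F≤P P≤2a) P≤2a)

  -- Serves both kinds of events: `t′` is either the completion time of `j` or a release time that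
  -- comes earlier.
  advance : Invariant t U F (j ∷ P) rem c R D → length F ℕ.≤ length (j ∷ P) →
    t ≤ t′ → t′ ≤ t + rem j → All (λ q → t′ ≤ r q) U →
    rem′ j + t′ ≡ rem j + t → (∀ q → q ≢ j → rem′ q ≡ rem q) →
    Invariant t′ U F (j ∷ P) rem′ c R D
  advance {t} {U} {F} {j} {P} {rem} {c} {R} {D} {t′} {rem′} I F≤P t≤t′ t′≤ t′≤U rem′j same = record
    { jobs       = jobs I
    ; releases   = releases I
    ; chronology = chronology I
    ; future     = t′≤U
    ; sorted     = sorted I
    ; fresh      = All.zipWith (λ (e , q≢j) → trans (same _ q≢j) e) (fresh I , ≢-sym-All (proj₁ (proj₂ unique)))
    ; 0≤rem      = 0≤rem′
    ; key        = key′
    ; ledger     = ledger-advance I F≤P t≤t′ t′≤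
    }
    where
    unique = top-unique I

    0≤rem′ : ∀ q → 0# ≤ rem′ q
    0≤rem′ q with q ≟ j
    ... | no  q≢j  = subst (0# ≤_) (sym (same q q≢j)) (0≤rem I q)
    ... | yes refl = +-cancelʳ-≤ t′ (subst₂ _≤_ (sym (+-identityˡ t′)) (trans (+-comm t (rem j)) (sym rem′j)) t′≤)

    excess-same : ∀ m → excess rem′ m P ≡ excess rem m P
    excess-same m = excess-cong (All.map (same _) (≢-sym-All (proj₁ unique)))

    key′ : ∀ {A B} → Interleaving A B R →
      excess size (2 ℕ.* length A) F + excess rem′ (2 ℕ.* length A) (j ∷ P)
        + ∑ (λ q → done q t′) B ≤ ∑ size B
    key′ {A} {B} i with 2 ℕ.* length A ℕ.≤? length P
    -- Neither bin has more than `m` jobs, so no pending job is counted.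
    ... | no  m≰ = begin
      excess size m F + 0# + ∑ (λ q → done q t′) B
        ≡⟨ cong (λ x → x + 0# + ∑ (λ q → done q t′) B) (excess-short m F (ℕₚ.≤-trans F≤P (ℕₚ.≰⇒> m≰))) ⟩
      0# + 0# + ∑ (λ q → done q t′) B
        ≡⟨ 0+0+x≡x _ ⟩
      ∑ (λ q → done q t′) B
        ≤⟨ ∑-mono (All.universal (λ q → done≤processing q t′) B) ⟩
      ∑ size B ∎
      where
      m = 2 ℕ.* length A
    -- The top job is counted and shrinks at unit rate, which offsets any progress of `S` on `B`.
    ... | yes m≤ = +-cancelʳ-≤ (t′ + t) (begin
      X + (rem′ j + excess rem′ m P) + d′ + (t′ + t)
        ≡⟨ cong (λ y → X + (rem′ j + y) + d′ + (t′ + t)) (excess-same m) ⟩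
      X + (rem′ j + Y) + d′ + (t′ + t)
        ≡⟨ solve 6 (λ X a Y d s t → ((X ⊕ (a ⊕ Y)) ⊕ d) ⊕ (s ⊕ t) ⊜ (X ⊕ Y ⊕ (a ⊕ s)) ⊕ (d ⊕ t)) refl X (rem′ j) Y d′ t′ t ⟩
      (X + (Y + (rem′ j + t′))) + (d′ + t)
        ≤⟨ +-mono-≤ (≤-reflexive (cong (λ y → X + (Y + y)) rem′j))
                    (done-rate (right-unique i (AllPairs-++⁻ʳ U (unique-↭ (releases I)))) t≤t′) ⟩
      (X + (Y + (rem j + t))) + (d + t′)
        ≡⟨ solve 6 (λ X a Y d s t → (X ⊕ Y ⊕ (a ⊕ t)) ⊕ (d ⊕ s) ⊜ ((X ⊕ (a ⊕ Y)) ⊕ d) ⊕ (s ⊕ t)) refl X (rem j) Y d t′ t ⟩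
      X + (rem j + Y) + d + (t′ + t)
        ≡⟨ cong (λ y → X + y + d + (t′ + t)) (sym (excess-∷ m j P m≤)) ⟩
      X + excess rem m (j ∷ P) + d + (t′ + t)
        ≤⟨ +-mono-≤ (key I i) ≤-refl ⟩
      ∑ size B + (t′ + t) ∎)
      where
      m  = 2 ℕ.* length A
      X  = excess size m F
      Y  = excess rem m P
      d  = ∑ (λ q → done q t) B
      d′ = ∑ (λ q → done q t′) B

  -- With nothing pending, the cost of the algorithm stands still, and `key` only says that `S`
  -- processes no job beyond its size.
  idle : Invariant t U [] [] rem c R D → t ≤ t′ → All (λ q → t′ ≤ r q) U →
         Invariant t′ U [] [] rem c R D
  idle {R = R} {t′ = t′} I t≤t′ t′≤U = record
    { jobs       = jobs I
    ; releases   = releases I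
    ; chronology = chronology I
    ; future     = t′≤U
    ; sorted     = sorted I
    ; fresh      = fresh I
    ; 0≤rem      = 0≤rem I
    ; key        = λ {_} {B} i → subst (_≤ ∑ size B)
                     (sym (0+0+x≡x _))
                     (∑-mono (All.universal (λ q → done≤processing q t′) B))
    ; ledger     = ≤-trans (ledger I) (·-monoʳ-≤ 4 (offlineCost-mono t≤t′ R))
    }

  -- The effect of a completion, a release and a move.

  removeTop : Invariant t U F (j ∷ P) rem c R D →
              Invariant t U F P rem (updateAt c j (const t)) R (j ∷ D)
  removeTop {t} {U} {F} {j} {P} {rem} {c} {R} {D} I = record
    { jobs       = Perm.trans (++⁺ˡ P (shift j (U ++ F) D))
                     (Perm.trans (shift j P ((U ++ F) ++ D)) (jobs I))
    ; releases   = releases I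
    ; chronology = chronology I
    ; future     = future I
    ; sorted     = sorted I
    ; fresh      = fresh I
    ; 0≤rem      = 0≤rem I
    -- The other jobs keep the same number of jobs below them.
    ; key        = λ {A} i → ≤-trans
                     (+-mono-≤ (+-mono-≤ ≤-refl (excess-tail-≤ (0≤rem I) (2 ℕ.* length A) j P)) ≤-refl)
                     (key I i)
    ; ledger     = subst (_≤ 4 · offlineCost t R) (sym moved) (ledger I)
    }
    where
    c′ = updateAt c j (const t)

    -- The share `t - r j` accrued so far becomes the final flow time of `j`.
    moved : onlineCost t (F ++ P) c′ (j ∷ D) ≡ onlineCost t (F ++ j ∷ P) c D
    moved = begin-equality
      ∑ (λ q → t - r q) (F ++ P) + (c′ j - r j + ∑ (λ q → c′ q - r q) D)
        ≡⟨ cong₂ (λ x y → ∑ (λ q → t - r q) (F ++ P) + (x - r j + y))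
             (updateAt-updates j c)
             (∑-cong (All.map (λ q≢j → cong (_- _) (updateAt-minimal _ j c q≢j))
               (≢-sym-All (proj₂ (proj₂ (top-unique I)))))) ⟩
      ∑ (λ q → t - r q) (F ++ P) + (t - r j + ∑ (λ q → c q - r q) D)
        ≡⟨ trans (x∙yz≈y∙xz _ _ _) (sym (+-assoc _ _ _)) ⟩
      t - r j + ∑ (λ q → t - r q) (F ++ P) + ∑ (λ q → c q - r q) D
        ≡⟨ cong (_+ _) (sym (∑-↭ (λ q → t - r q) (shift j F P))) ⟩
      onlineCost t (F ++ j ∷ P) c D ∎

  release-top : Invariant t (q ∷ U) F P rem c R D → t ≡ r q →
                Invariant t U (uponJobRelease q F) P rem c (q ∷ R) D
  release-top {t} {q} {U} {F} {P} {rem} {c} {R} {D} I t≡r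
    rewrite uponJobRelease-insert q F (sorted I) = record
    { jobs       = Perm.trans (++⁺ˡ P (++⁺ʳ D moved)) (jobs I)
    ; releases   = Perm.trans (shift q U R) (releases I)
    ; chronology = AllPairs.tail (chronology I)
    ; future     = All.tail (future I)
    ; sorted     = insert-sorted q (sorted I)
    ; fresh      = All-resp-↭ (Perm.↭-sym moved) (fresh I)
    ; 0≤rem      = 0≤rem I
    ; key        = key′
    ; ledger     = ledger′
    }
    where
    moved : U ++ insert q F ↭ q ∷ U ++ F
    moved = Perm.trans (++⁺ˡ U (insert-↭ q F)) (shift q U F)

    key′ : ∀ {A B} → Interleaving A B (q ∷ R) →
      excess size (2 ℕ.* length A) (insert q F) + excess rem (2 ℕ.* length A) P
        + ∑ (λ q → done q t) B ≤ ∑ size B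
    -- With `q` excluded, the old bound is used for one excluded job fewer, that is, for a threshold
    -- lower by two.
    key′ {_ ∷ A} (consˡ i) rewrite ℕₚ.*-suc 2 (length A) = ≤-trans
      (+-mono-≤ (+-mono-≤ (excess-insert-shift (2 ℕ.* length A) q F (sorted I))
                          (excess-antitone (0≤rem I) P (ℕₚ.m≤n+m (2 ℕ.* length A) 2)))
                ≤-refl)
      (key I i)
    -- At its release `S` has done nothing on `q`, so its whole size is added on the right.
    key′ {A} {_ ∷ B} (consʳ i) = begin
      excess size m (insert q F) + excess rem m P + (done q t + ∑ (λ q → done q t) B)
        ≤⟨ +-mono-≤ (+-mono-≤ (excess-insert m q F) ≤-refl)
                    (≤-reflexive (trans (cong (_+ _) (done-release (≤-reflexive t≡r))) (+-identityˡ _))) ⟩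
      size q + excess size m F + excess rem m P + ∑ (λ q → done q t) B
        ≡⟨ trans (cong (_+ ∑ (λ q → done q t) B) (+-assoc _ _ _)) (+-assoc _ _ _) ⟩
      size q + (excess size m F + excess rem m P + ∑ (λ q → done q t) B)
        ≤⟨ +-mono-≤ ≤-refl (key I i) ⟩
      size q + ∑ size B ∎
      where
      m = 2 ℕ.* length A

    ledger′ : onlineCost t (insert q F ++ P) c D ≤ 4 · offlineCost t (q ∷ R)
    ledger′ = begin
      ∑ (λ p → t - r p) (insert q F ++ P) + ∑ (λ p → c p - r p) D
        ≡⟨ cong (_+ _) (∑-↭ (λ p → t - r p) (++⁺ʳ P (insert-↭ q F))) ⟩
      t - r q + ∑ (λ p → t - r p) (F ++ P) + ∑ (λ p → c p - r p) D
        ≡⟨ cong (λ x → x + ∑ (λ p → t - r p) (F ++ P) + ∑ (λ p → c p - r p) D)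
             (trans (cong (_- r q) t≡r) (-‿inverseʳ (r q))) ⟩
      0# + ∑ (λ p → t - r p) (F ++ P) + ∑ (λ p → c p - r p) D
        ≡⟨ cong (_+ _) (+-identityˡ _) ⟩
      onlineCost t (F ++ P) c D
        ≤⟨ ledger I ⟩
      4 · offlineCost t R
        -- The new job must not lower the cost of `S`: `t ⊓ c* q` is at least `r q`.
        ≤⟨ ·-monoʳ-≤ 4 (x≤y+x (x≤y⇒0≤y-x (⊓-glb (≤-reflexive (sym t≡r)) (release≤completion q)))) ⟩
      4 · offlineCost t (q ∷ R) ∎

  -- By `fresh` the job has not been processed, so its weight is the same in both bins, and with
  -- equally many jobs below it, it meets the same thresholds.
  moveTop : Invariant t U (q ∷ F) P rem c R D → length P ≡ length F →
            Invariant t U F (q ∷ P) rem c R D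
  moveTop {t} {U} {q} {F} {P} {rem} {c} {R} {D} I P≡F = record
    { jobs       = Perm.trans (Perm.↭-sym moved) (jobs I)
    ; releases   = releases I
    ; chronology = chronology I
    ; future     = future I
    ; sorted     = AllPairs.tail (sorted I)
    ; fresh      = All.tail fresh′
    ; 0≤rem      = 0≤rem I
    ; key        = λ {A} {B} i → subst (λ x → x + ∑ (λ p → done p t) B ≤ ∑ size B)
                     (exchange (2 ℕ.* length A)) (key I i)
    ; ledger     = subst (λ x → x + ∑ (λ p → c p - r p) D ≤ 4 · offlineCost t R)
                     (sym (∑-↭ (λ p → t - r p) (shift q F P))) (ledger I)
    }
    where
    moved : P ++ ((U ++ q ∷ F) ++ D) ↭ q ∷ P ++ ((U ++ F) ++ D)
    moved = Perm.trans (++⁺ˡ P (++⁺ʳ D (shift q U F))) (shift q P ((U ++ F) ++ D))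

    fresh′ : All (λ p → rem p ≡ size p) (q ∷ U ++ F)
    fresh′ = All-resp-↭ (shift q U F) (fresh I)

    exchange : ∀ m → excess size m (q ∷ F) + excess rem m P ≡ excess size m F + excess rem m (q ∷ P)
    exchange m with m ℕ.≤? length F
    ... | yes m≤ = trans
      (cong (λ x → x + excess size m F + excess rem m P) (sym (All.head fresh′)))
      (trans (solve 3 (λ a x y → (a ⊕ x) ⊕ y ⊜ x ⊕ (a ⊕ y)) refl (rem q) (excess size m F) (excess rem m P))
        (cong (excess size m F +_) (sym (excess-∷ m q P (subst (m ℕ.≤_) (sym P≡F) m≤)))))
    ... | no  m≰ = cong₂ _+_
      (sym (excess-short m F (ℕₚ.<⇒≤ F<m)))
      (trans (excess-short m P (ℕₚ.<⇒≤ P<m)) (sym (excess-short m (q ∷ P) P<m)))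
      where
      F<m = ℕₚ.≰⇒> m≰
      P<m = subst (ℕ._< m) (sym P≡F) F<m

  -- Balanced bins and the run of the algorithm.

  record Balanced (s : State n) (events : ℕ) : Set where
    open State s
    field
      {released completed} : List (Fin n)
      invariant  : Invariant clock unreleased full partial remaining completedAt released completed
      full≤partial   : length full ℕ.≤ length partial
      partial≤1+full : length partial ℕ.≤ suc (length full)
      -- An unreleased job still has two events ahead, a pending one has one; moves between the bins
      -- are not events.
      count      : 2 ℕ.* length unreleased ℕ.+ (length full ℕ.+ length partial) ≡ events

  uponHeavyF-stay : ∀ F P → length F ℕ.≤ length P → uponHeavyF F P ≡ (F , P)
  uponHeavyF-stay []      P _   = refl
  uponHeavyF-stay (q ∷ F) P F≤P with length P ℕ.<? length (q ∷ F)
  ... | yes P<F = contradiction F≤P (ℕₚ.<⇒≱ P<F)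
  ... | no  _   = refl

  uponHeavyF-move : ∀ q F P → length P ≡ length F → uponHeavyF (q ∷ F) P ≡ (F , q ∷ P)
  uponHeavyF-move q F P P≡F with length P ℕ.<? length (q ∷ F)
  ... | yes _   = uponHeavyF-stay F (q ∷ P) (ℕₚ.m≤n⇒m≤1+n (ℕₚ.≤-reflexive (sym P≡F)))
  ... | no  P≮F = contradiction (s≤s (ℕₚ.≤-reflexive P≡F)) P≮F

  -- Before an event, |P| is |F| or |F| + 1. A release enlarges F by one and a completion shrinks P
  -- by one, so either way |F| is then |P| or |P| + 1 and at most one move follows.
  rebalance : ∀ {k} F P → Invariant t U F P rem c R D →
    length P ℕ.≤ length F → length F ℕ.≤ suc (length P) →
    2 ℕ.* length U ℕ.+ (length F ℕ.+ length P) ≡ k →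
    Balanced (rebalanced t U F P rem c) k
  rebalance {t} {U} {rem} {c} {k = k} F P I P≤F F≤P e = settle F I P≤F F≤P e (length F ℕ.≤? length P)
    where
    withBins : Bin n × Bin n → State n
    withBins b = record
      { clock = t ; unreleased = U ; full = proj₁ b ; partial = proj₂ b
      ; remaining = rem ; completedAt = c }

    settle : ∀ F → Invariant t U F P rem c _ _ → length P ℕ.≤ length F → length F ℕ.≤ suc (length P) →
      2 ℕ.* length U ℕ.+ (length F ℕ.+ length P) ≡ k → Dec (length F ℕ.≤ length P) →
      Balanced (rebalanced t U F P rem c) k
    settle F I P≤F _ e (yes F≤P) = subst (λ b → Balanced (withBins b) k) (sym (uponHeavyF-stay F P F≤P))
      record { invariant = I ; full≤partial = F≤P ; partial≤1+full = ℕₚ.m≤n⇒m≤1+n P≤F ; count = e }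
    settle []      _ _ _         _ (no F≰P) = contradiction z≤n F≰P
    settle (q ∷ F) I _ (s≤s F≤P) e (no F≰P) =
      subst (λ b → Balanced (withBins b) k) (sym (uponHeavyF-move q F P P≡F)) record
        { invariant      = moveTop I P≡F
        ; full≤partial   = ℕₚ.m≤n⇒m≤1+n F≤P
        ; partial≤1+full = s≤s (ℕₚ.≤-reflexive P≡F)
        ; count          = trans (cong (2 ℕ.* length U ℕ.+_) (ℕₚ.+-suc (length F) (length P))) e
        }
      where
      P≡F : length P ≡ length F
      P≡F = ℕₚ.≤-antisym (ℕₚ.≤-pred (ℕₚ.≰⇒> F≰P)) F≤P

  length-release : ∀ q F → Sorted F → length (uponJobRelease q F) ≡ suc (length F)
  length-release q F sorted = trans (cong length (uponJobRelease-insert q F sorted)) (↭-length (insert-↭ q F))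

  release-balanced : ∀ {k} → Invariant (r q) (q ∷ U) F P rem c R D →
    length F ℕ.≤ length P → length P ℕ.≤ suc (length F) →
    2 ℕ.* length (q ∷ U) ℕ.+ (length F ℕ.+ length P) ≡ suc k →
    Balanced (rebalanced (r q) U (uponJobRelease q F) P rem c) k
  release-balanced {q} {U} {F} {P} {k = k} I F≤P P≤F e = rebalance (uponJobRelease q F) P (release-top I refl)
    (subst (length P ℕ.≤_) (sym |F|+1) P≤F)
    (subst (ℕ._≤ suc (length P)) (sym |F|+1) (s≤s F≤P))
    (trans (cong (λ x → 2 ℕ.* length U ℕ.+ (x ℕ.+ length P)) |F|+1)
      (trans (ℕₚ.+-suc (2 ℕ.* length U) (length F ℕ.+ length P))
        (ℕₚ.suc-injective (trans (sym (cong (ℕ._+ (length F ℕ.+ length P)) (ℕₚ.*-suc 2 (length U)))) e))))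
    where
    |F|+1 = length-release q F (sorted I)

  completion-balanced : ∀ {k} → Invariant t U F (j ∷ P) rem c R D →
    length F ℕ.≤ length (j ∷ P) → length (j ∷ P) ℕ.≤ suc (length F) →
    2 ℕ.* length U ℕ.+ (length F ℕ.+ length (j ∷ P)) ≡ suc k →
    All (λ q → t + rem j ≤ r q) U →
    Balanced (rebalanced (t + rem j) U F P (updateAt rem j (const 0#)) (updateAt c j (const (t + rem j)))) k
  completion-balanced {t} {U} {F} {j} {P} {rem} I F≤P P≤F e t′≤U = rebalance F P
    (removeTop (advance I F≤P (x≤x+y (0≤rem I j)) ≤-refl t′≤U
      (trans (cong (_+ _) (updateAt-updates j rem)) (trans (+-identityˡ _) (+-comm _ _)))
      (λ q q≢j → updateAt-minimal q j rem q≢j)))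
    (ℕₚ.≤-pred P≤F) F≤P
    (ℕₚ.suc-injective (trans
      (sym (trans (cong (2 ℕ.* length U ℕ.+_) (ℕₚ.+-suc (length F) (length P))) (ℕₚ.+-suc _ _))) e))

  upto : ∀ {q} → AllPairs (λ p q → r p ≤ r q) (q ∷ U) → All (λ p → r q ≤ r p) (q ∷ U)
  upto (q≤U ∷ _) = ≤-refl ∷ q≤U

  step-balanced : ∀ {k} s → Balanced s (suc k) → Balanced (step s) k
  step-balanced record { unreleased = [] ; full = [] ; partial = [] } record { count = () }
  step-balanced record { unreleased = [] ; partial = j ∷ P }
    record { invariant = I ; full≤partial = F≤P ; partial≤1+full = P≤F ; count = e } =
    completion-balanced I F≤P P≤F e []
  -- By `full≤partial`, an empty partial bin forces an empty full bin, so the machine idles until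
  -- the release.
  step-balanced record { unreleased = q ∷ U ; full = [] ; partial = [] }
    record { invariant = I ; count = e } =
    release-balanced (idle I (All.head (future I)) (upto (chronology I))) z≤n z≤n e
  step-balanced record { clock = t ; unreleased = q ∷ U ; partial = j ∷ P ; remaining = rem }
    record { invariant = I ; full≤partial = F≤P ; partial≤1+full = P≤F ; count = e }
    with t + rem j ≤? r q
  ... | yes t+rem≤r = completion-balanced I F≤P P≤F e (All.map (≤-trans t+rem≤r) (upto (chronology I)))
  ... | no  t+rem≰r = release-balanced
    (advance I F≤P (All.head (future I)) (≰⇒≥ t+rem≰r) (upto (chronology I))
      (begin-equality
        updateAt rem j (_- d) j + r q ≡⟨ cong (_+ r q) (updateAt-updates j rem) ⟩
        rem j - d + r q               ≡⟨ cong (rem j - d +_) (sym (x-y+y≡x (r q) t)) ⟩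
        rem j - d + (d + t)           ≡⟨ sym (+-assoc _ d t) ⟩
        rem j - d + d + t             ≡⟨ cong (_+ t) (x-y+y≡x (rem j) d) ⟩
        rem j + t                     ∎)
      (λ p p≢j → updateAt-minimal p j rem p≢j))
    F≤P P≤F e
    where
    d = r q - t

  finished : ∀ s → Balanced s 0 → flowTime Q (State.completedAt s) ≤ 4 · cost Q S
  finished record { clock = t ; unreleased = [] ; full = [] ; partial = [] ; completedAt = c }
    record { released = R ; completed = D ; invariant = I } = begin
    flowTime Q c                       ≡⟨ sym (∑-allFin (λ q → c q - r q)) ⟩
    ∑ (λ q → c q - r q) (allFin n)     ≡⟨ sym (∑-↭ (λ q → c q - r q) (jobs I)) ⟩
    ∑ (λ q → c q - r q) D              ≡⟨ sym (+-identityˡ _) ⟩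
    0# + ∑ (λ q → c q - r q) D         ≤⟨ ledger I ⟩
    -- `S` may finish jobs after the last event of the algorithm; truncating at `t` only lowers its
    -- cost.
    4 · offlineCost t R                ≤⟨ ·-monoʳ-≤ 4 (∑-mono (All.universal (λ q → +-mono-≤ (x⊓y≤y t (c* q)) ≤-refl) R)) ⟩
    4 · ∑ (λ q → c* q - r q) R         ≡⟨ cong (4 ·_) (∑-↭ (λ q → c* q - r q) (releases I)) ⟩
    4 · ∑ (λ q → c* q - r q) (allFin n) ≡⟨ cong (4 ·_) (∑-allFin (λ q → c* q - r q)) ⟩
    4 · cost Q S                       ∎
    where
    ∑-allFin : ∀ f → ∑ f (allFin n) ≡ sum f
    ∑-allFin f = ∑-tabulate f id
  finished record { unreleased = [] ; full = [] ; partial = _ ∷ _ } record { count = () }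
  finished record { unreleased = [] ; full = _ ∷ _ } record { count = () }
  finished record { unreleased = _ ∷ _ } record { count = () }

  run : ∀ k s → Balanced s k → flowTime Q (State.completedAt (steps k s)) ≤ 4 · cost Q S
  run zero    s b = finished s b
  run (suc k) s b = run k (step s) (step-balanced s b)

  initial-balanced : ∀ o → Balanced (initial o) (2 ℕ.* n)
  initial-balanced o = record
    { released = []
    ; completed = []
    ; invariant = record
      { jobs       = subst (_↭ allFin n) (sym (trans (++-identityʳ (sequence o ++ [])) (++-identityʳ _))) (enumerates o)
      ; releases   = subst (_↭ allFin n) (sym (++-identityʳ _)) (enumerates o)
      ; chronology = ReleaseOrder.sorted o
      ; future     = All.universal (λ q → release≥0 (Q q)) _
      ; sorted     = []
      ; fresh      = All.universal (λ _ → refl) _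
      ; 0≤rem      = 0≤size
      ; key        = λ { [] → ≤-reflexive (trans (+-identityʳ _) (+-identityʳ _)) }
      ; ledger     = subst (_≤ 4 · 0#) (sym (+-identityʳ 0#)) (·-nonNeg 4 ≤-refl)
      }
    ; full≤partial = z≤n
    ; partial≤1+full = z≤n
    ; count = trans (ℕₚ.+-identityʳ _)
        (cong (2 ℕ.*_) (trans (↭-length (enumerates o)) (length-tabulate {n = n} id)))
    }

  four-competitive : ∀ o → flowTime Q (completionTimes o) ≤ 4 · cost Q S
  four-competitive o = run (2 ℕ.* n) (initial o) (initial-balanced o)

-- Application to the base-2 classes and an optimal schedule.

module _ (K : ArchimedeanOrderedField) where

  open ArchimedeanOrderedField K
  open BinaryLog K using (floorLog₂)
  open CommutativeRing commutativeRing using (distribʳ)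
  open OrderedField K
  open PowersOfTwo K
  open Scheduling K

  binary-classes : ∀ {n} (Q : Input n) → Classes K (λ q → processing (Q q)) (λ q → 2^ class (Q q))
  binary-classes Q = record
    { 0≤p̃     = λ q → 0≤2^ (class (Q q))
    ; p̃≤size  = λ q → proj₁ (proj₂ (log q))
    ; size≤2p̃ = λ q → subst (processing (Q q) ≤_) (2^-suc (class (Q q))) (proj₁ (proj₂ (proj₂ (log q))))
    ; p̃-gap   = λ x q → 2^-gap (class (Q x)) (class (Q q))
    }
    where
    log = λ q → floorLog₂ (processing (Q q)) (processing>0 (Q q))

  4·x≡[2+2]*x : ∀ x → 4 · x ≡ (2# + 2#) * x
  4·x≡[2+2]*x x = begin-equality
    x + (x + (x + (x + 0#)))  ≡⟨ cong (λ y → x + (x + (x + y))) (+-identityʳ x) ⟩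
    x + (x + (x + x))         ≡⟨ sym (+-assoc x x (x + x)) ⟩
    (x + x) + (x + x)         ≡⟨ sym (cong₂ _+_ (2*x≡x+x x) (2*x≡x+x x)) ⟩
    2# * x + 2# * x           ≡⟨ sym (distribʳ x 2# 2#) ⟩
    (2# + 2#) * x             ∎

corollaryD3 : (K : ArchimedeanOrderedField) →
    let open ArchimedeanOrderedField K
        open Scheduling K
    in (n : ℕ) (Q : Input n) (o : ReleaseOrder Q) (opt : Carrier) →
       IsOPT Q opt → costALG Q o ≤ (2# + 2#) * opt
corollaryD3 K n Q o opt ((S , feasible , cost≡opt) , _) =
  subst₂ _≤_ refl (trans (cong (4 ·_) cost≡opt) (4·x≡[2+2]*x K opt))
    (TwoBinAnalysis.four-competitive K feasible (binary-classes K Q) o)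
  where
  open ArchimedeanOrderedField K
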